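{- Let $n\geq 1$ and $0\leq k\leq n-1$ be integers, and let $Q_n^{(k)}(x)$ be the $k$th derivative of $Q_n(x)$. If $n+k+1$ is prime, or if $2n+1$ is prime, then $Q_n^{(k)}(x)$ is irreducible over $\mathbb{Q}$.
   Context: For each integer $n\geq 0$, $P_n(x),Q_n(x)\in\mathbb{Q}[x]$ denote the unique pair of polynomials with $\deg P_n\leq n$, $\deg Q_n\leq n$ satisfying $P_n(x)x^{n+1}+Q_n(x)(x+1)^{n+1}=1$. -}

module Defs where

open import Data.Nat as ℕ using (ℕ; zero; suc)
open import Data.Integer using (+_)
open import Data.Rational using (ℚ; 0ℚ; 1ℚ; _/_)
import Data.Rational as Q
open import Data.List using (List; []; _∷_)
open import Data.Product using (∃; _×_)
open import Data.Sum using (_⊎_)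
open import Relation.Binary.PropositionalEquality using (_≡_)
open import Relation.Nullary using (¬_)

-- Polynomials over ℚ, as lists of coefficients, constant term first.
-- Trailing zeros are allowed; polynomials are compared coefficientwise.
Poly : Set
Poly = List ℚ

coeff : Poly → ℕ → ℚ
coeff []       _       = 0ℚ
coeff (a ∷ f)  zero    = a
coeff (a ∷ f)  (suc i) = coeff f i

infix 4 _≈ₚ_
_≈ₚ_ : Poly → Poly → Set
f ≈ₚ g = ∀ i → coeff f i ≡ coeff g i

DegLe : Poly → ℕ → Set
DegLe f n = ∀ i → n ℕ.< i → coeff f i ≡ 0ℚ

infixl 6 _+ₚ_
_+ₚ_ : Poly → Poly → Poly
[]      +ₚ g       = g
(a ∷ f) +ₚ []      = a ∷ f
(a ∷ f) +ₚ (b ∷ g) = (a Q.+ b) ∷ (f +ₚ g)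

scale : ℚ → Poly → Poly
scale c []      = []
scale c (a ∷ f) = (c Q.* a) ∷ scale c f

infixl 7 _*ₚ_
_*ₚ_ : Poly → Poly → Poly
[]      *ₚ g = []
(a ∷ f) *ₚ g = scale a g +ₚ (0ℚ ∷ (f *ₚ g))

oneₚ : Poly
oneₚ = 1ℚ ∷ []

X : Poly
X = 0ℚ ∷ 1ℚ ∷ []

X+1 : Poly
X+1 = 1ℚ ∷ 1ℚ ∷ []

infixr 8 _^ₚ_
_^ₚ_ : Poly → ℕ → Poly
f ^ₚ zero  = oneₚ
f ^ₚ suc m = f *ₚ (f ^ₚ m)

ℕtoℚ : ℕ → ℚ
ℕtoℚ k = + k / 1

derivAux : ℕ → Poly → Poly
derivAux k []      = []
derivAux k (b ∷ f) = (ℕtoℚ k Q.* b) ∷ derivAux (suc k) f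

deriv : Poly → Poly
deriv []      = []
deriv (a ∷ f) = derivAux 1 f

derivⁿ : ℕ → Poly → Poly
derivⁿ zero    f = f
derivⁿ (suc k) f = deriv (derivⁿ k f)

IsUnit : Poly → Set
IsUnit f = ∃ λ c → ¬ (c ≡ 0ℚ) × (f ≈ₚ (c ∷ []))

Irreducible : Poly → Set
Irreducible f =
  ¬ (f ≈ₚ []) × ¬ IsUnit f ×
  (∀ g h → f ≈ₚ g *ₚ h → IsUnit g ⊎ IsUnit h)

IsPQPair : ℕ → Poly → Poly → Set
IsPQPair n P Q =
  DegLe P n × DegLe Q n ×
  (P *ₚ (X ^ₚ suc n) +ₚ Q *ₚ (X+1 ^ₚ suc n) ≈ₚ oneₚ)

{-# OPTIONS --safe #-}

-- Comparing coefficients in Q (1 + x)^(n+1) ≡ 1 mod x^(n+1) shows that f = Q^(k) satisfies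
-- (i + 1) f_{i+1} = - (K + i) f_i for i < m, where K = n + k + 1 and m = n - k = deg f.
-- Normalise f_0 = 1.  If K = p is prime, the recurrence makes every f_i with 1 ≤ i ≤ m exactly
-- divisible by p, and Eisenstein applies to the reversed polynomial.  If K + m = 2n + 1 = p is
-- prime, all f_i are p-adic units and the recurrence reads (1 + x) f' + K f = p f_m x^m.  In the
-- variable y = x + 1 the left side is diagonal, so f = Σ b_i y^i with (K + i) b_i = p f_m [y^i](y - 1)^m,
-- and Eisenstein applies to f as a polynomial in y.  Factors over ℚ are brought into ℤ₍ₚ₎ by
-- clearing denominators and removing the powers of p from the multiplier with Gauss's lemma.
module Submission where

open import Defs
open import Data.Nat using (ℕ; _+_; _*_; _≤_; _<_)
open import Data.Nat.Primality using (Prime)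
open import Data.Sum using (_⊎_)
open import Data.Nat using (zero; suc; z≤n; s≤s)
import Data.Nat as ℕ
import Data.Nat.Properties as ℕₚ
open import Data.Nat.Divisibility using (_∣_; _∣?_; divides; ∣-refl; >⇒∤; ∣m+n∣m⇒∣n; m∣m*n)
open import Data.Nat.Induction using (<-rec)
open import Data.Nat.Primality using (euclidsLemma; prime⇒nonZero; prime⇒nonTrivial)
open import Data.Integer using (ℤ; +_; ∣_∣)
import Data.Integer as ℤ
import Data.Integer.Properties as ℤₚ
open import Data.Integer.Divisibility.Signed using (∣ᵤ⇒∣) renaming (divides to dividesℤ)
open import Data.Rational using (ℚ; 0ℚ; 1ℚ; _/_) renaming (_+_ to _+ℚ_; _*_ to _*ℚ_; -_ to -ℚ_)
import Data.Rational as ℚ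
import Data.Rational.Properties as ℚₚ
open import Data.Rational.Unnormalised using (mkℚᵘ; *≡*; _≃_)
import Data.Rational.Unnormalised as ℚᵘ
import Data.Rational.Unnormalised.Properties as ℚᵘₚ
open import Data.Rational.Solver using (module +-*-Solver)
open +-*-Solver using (solve; con; _:=_; _:+_; _:*_; :-_)
open import Data.List using ([]; _∷_)
open import Data.Product using (∃; _×_; _,_; proj₁; proj₂)
open import Data.Sum using (inj₁; inj₂; [_,_]′; map; map₁)
open import Data.Empty using (⊥-elim)
open import Relation.Nullary using (¬_; yes; no)
open import Relation.Binary.Definitions using (Tri; tri<; tri≈; tri>)
open import Relation.Binary.PropositionalEquality using (_≡_; refl; sym; trans; cong; cong₂; subst; module ≡-Reasoning)

-- Differentiation raises `K` by one and lowers `m` by one, so `K` becomes n + k + 1 while K + m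
-- keeps the value 2n + 1 for every k; this is where the two primality conditions come from. In both
-- cases m < p, so the divisors i + 1 in the recurrence are units of ℤ₍ₚ₎, and p-integrality of the
-- normalised coefficients follows from the recurrence itself, without binomial coefficients. When K
-- + m = p, the equation for f reduces modulo p to (1 + x) f' = m f, so f is congruent to f_m (1 +
-- x)^m, a constant times a power of y. This is why Eisenstein's criterion becomes available in y
-- although none of f_0, ..., f_m is divisible by p.

-- The embedding of ℤ into ℚ, and inverses in ℚ

ι : ℤ → ℚ
ι z = z / 1

-- Forming `z / 1` normalises the fraction, which blocks direct computation; identities about `ι`
-- are therefore checked on unnormalised fractions, where the second argument `0` of `mkℚᵘ` encodes
-- the denominator 1.
toℚᵘ-ι : ∀ z → ℚ.toℚᵘ (ι z) ≃ mkℚᵘ z 0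
toℚᵘ-ι z = ℚₚ.toℚᵘ-fromℚᵘ (mkℚᵘ z 0)

ι-+ : ∀ a b → ι (a ℤ.+ b) ≡ ι a +ℚ ι b
ι-+ a b = ℚₚ.toℚᵘ-injective (begin
  ℚ.toℚᵘ (ι (a ℤ.+ b))                ≈⟨ toℚᵘ-ι (a ℤ.+ b) ⟩
  mkℚᵘ (a ℤ.+ b) 0                     ≈⟨ *≡* (cong (ℤ._* + 1) (sym (cong₂ ℤ._+_ (ℤₚ.*-identityʳ a) (ℤₚ.*-identityʳ b)))) ⟩
  mkℚᵘ a 0 ℚᵘ.+ mkℚᵘ b 0               ≈⟨ ℚᵘₚ.+-cong (toℚᵘ-ι a) (toℚᵘ-ι b) ⟨
  ℚ.toℚᵘ (ι a) ℚᵘ.+ ℚ.toℚᵘ (ι b)       ≈⟨ ℚₚ.toℚᵘ-homo-+ (ι a) (ι b) ⟨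
  ℚ.toℚᵘ (ι a +ℚ ι b)                  ∎)
  where open ℚᵘₚ.≃-Reasoning

ι-* : ∀ a b → ι (a ℤ.* b) ≡ ι a *ℚ ι b
ι-* a b = ℚₚ.toℚᵘ-injective (begin
  ℚ.toℚᵘ (ι (a ℤ.* b))                ≈⟨ toℚᵘ-ι (a ℤ.* b) ⟩
  mkℚᵘ a 0 ℚᵘ.* mkℚᵘ b 0               ≈⟨ ℚᵘₚ.*-cong (toℚᵘ-ι a) (toℚᵘ-ι b) ⟨
  ℚ.toℚᵘ (ι a) ℚᵘ.* ℚ.toℚᵘ (ι b)       ≈⟨ ℚₚ.toℚᵘ-homo-* (ι a) (ι b) ⟨
  ℚ.toℚᵘ (ι a *ℚ ι b)                  ∎)
  where open ℚᵘₚ.≃-Reasoning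

ι-injective : ∀ {a b} → ι a ≡ ι b → a ≡ b
ι-injective {a} {b} eq with ℚₚ./-injective-≃ (mkℚᵘ a 0) (mkℚᵘ b 0) eq
... | *≡* a*1≡b*1 = trans (sym (ℤₚ.*-identityʳ a)) (trans a*1≡b*1 (ℤₚ.*-identityʳ b))

ι-↥ : ∀ x → ι (ℚ.↧ x) *ℚ x ≡ ι (ℚ.↥ x)
ι-↥ x@record{} = ℚₚ.toℚᵘ-injective (begin
  ℚ.toℚᵘ (ι (ℚ.↧ x) *ℚ x)              ≈⟨ ℚₚ.toℚᵘ-homo-* (ι (ℚ.↧ x)) x ⟩
  ℚ.toℚᵘ (ι (ℚ.↧ x)) ℚᵘ.* ℚ.toℚᵘ x     ≈⟨ ℚᵘₚ.*-congʳ (toℚᵘ-ι (ℚ.↧ x)) ⟩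
  mkℚᵘ (ℚ.↧ x) 0 ℚᵘ.* ℚ.toℚᵘ x         ≈⟨ *≡* (trans (ℤₚ.*-identityʳ _) (trans (ℤₚ.*-comm (ℚ.↧ x) (ℚ.↥ x)) (cong (ℚ.↥ x ℤ.*_) (sym (ℤₚ.*-identityˡ (ℚ.↧ x)))))) ⟩
  mkℚᵘ (ℚ.↥ x) 0                       ≈⟨ toℚᵘ-ι (ℚ.↥ x) ⟨
  ℚ.toℚᵘ (ι (ℚ.↥ x))                   ∎)
  where open ℚᵘₚ.≃-Reasoning

ℕtoℚ-+ : ∀ a b → ℕtoℚ (a + b) ≡ ℕtoℚ a +ℚ ℕtoℚ b
ℕtoℚ-+ a b = ι-+ (+ a) (+ b)

ℕtoℚ-* : ∀ a b → ℕtoℚ (a * b) ≡ ℕtoℚ a *ℚ ℕtoℚ b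
ℕtoℚ-* a b = trans (cong ι (ℤₚ.pos-* a b)) (ι-* (+ a) (+ b))

ℕtoℚ-suc : ∀ a → ℕtoℚ (suc a) ≡ 1ℚ +ℚ ℕtoℚ a
ℕtoℚ-suc = ℕtoℚ-+ 1

ℕtoℚ-suc≢0 : ∀ a → ¬ (ℕtoℚ (suc a) ≡ 0ℚ)
ℕtoℚ-suc≢0 a eq with ι-injective {+ suc a} {+ 0} eq
... | ()

module _ {x : ℚ} (x≢0 : ¬ (x ≡ 0ℚ)) where
  inverse : ℚ
  inverse = (ℚ.1/ x) {{ℚ.≢-nonZero x≢0}}

  inverseˡ : inverse *ℚ x ≡ 1ℚ
  inverseˡ = ℚₚ.*-inverseˡ x {{ℚ.≢-nonZero x≢0}}

  inverse-cancelˡ : ∀ y → inverse *ℚ (x *ℚ y) ≡ y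
  inverse-cancelˡ y = trans (sym (ℚₚ.*-assoc inverse x y)) (trans (cong (_*ℚ y) inverseˡ) (ℚₚ.*-identityˡ y))

  inverse-cancelʳ : ∀ y → x *ℚ (inverse *ℚ y) ≡ y
  inverse-cancelʳ y = trans (solve 3 (λ a b c → a :* (b :* c) := b :* (a :* c)) refl x inverse y) (inverse-cancelˡ y)

  *ℚ-cancelˡ : ∀ {y z} → x *ℚ y ≡ x *ℚ z → y ≡ z
  *ℚ-cancelˡ {y} {z} eq = trans (sym (inverse-cancelˡ y)) (trans (cong (inverse *ℚ_) eq) (inverse-cancelˡ z))

*ℚ-≢0 : ∀ {x y} → ¬ (x ≡ 0ℚ) → ¬ (y ≡ 0ℚ) → ¬ (x *ℚ y ≡ 0ℚ)
*ℚ-≢0 {x} x≢0 y≢0 eq = y≢0 (*ℚ-cancelˡ x≢0 (trans eq (sym (ℚₚ.*-zeroʳ x))))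

-- Coefficients of sums, products and derivatives

coeff-+ : ∀ f g i → coeff (f +ₚ g) i ≡ coeff f i +ℚ coeff g i
coeff-+ []      g       i       = sym (ℚₚ.+-identityˡ _)
coeff-+ (a ∷ f) []      i       = sym (ℚₚ.+-identityʳ _)
coeff-+ (a ∷ f) (b ∷ g) zero    = refl
coeff-+ (a ∷ f) (b ∷ g) (suc i) = coeff-+ f g i

coeff-scale : ∀ c f i → coeff (scale c f) i ≡ c *ℚ coeff f i
coeff-scale c []      i       = sym (ℚₚ.*-zeroʳ c)
coeff-scale c (a ∷ f) zero    = refl
coeff-scale c (a ∷ f) (suc i) = coeff-scale c f i

coeff-derivAux : ∀ k f i → coeff (derivAux k f) i ≡ ℕtoℚ (k + i) *ℚ coeff f i
coeff-derivAux k []      i       = sym (ℚₚ.*-zeroʳ (ℕtoℚ (k + i)))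
coeff-derivAux k (a ∷ f) zero    = cong (λ j → ℕtoℚ j *ℚ a) (sym (ℕₚ.+-identityʳ k))
coeff-derivAux k (a ∷ f) (suc i) =
  trans (coeff-derivAux (suc k) f i) (cong (λ j → ℕtoℚ j *ℚ coeff f i) (sym (ℕₚ.+-suc k i)))

coeff-deriv : ∀ f i → coeff (deriv f) i ≡ ℕtoℚ (suc i) *ℚ coeff f (suc i)
coeff-deriv []      i = sym (ℚₚ.*-zeroʳ (ℕtoℚ (suc i)))
coeff-deriv (a ∷ f) i = coeff-derivAux 1 f i

∷-cong : ∀ {a b f g} → a ≡ b → f ≈ₚ g → a ∷ f ≈ₚ b ∷ g
∷-cong a≡b f≈g zero    = a≡b
∷-cong a≡b f≈g (suc i) = f≈g i

0∷-[] : ∀ {f} → f ≈ₚ [] → 0ℚ ∷ f ≈ₚ []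
0∷-[] f≈[] zero    = refl
0∷-[] f≈[] (suc i) = f≈[] i

coeff-0∷-+ : ∀ f g i → coeff (0ℚ ∷ (f +ₚ g)) i ≡ coeff (0ℚ ∷ f) i +ℚ coeff (0ℚ ∷ g) i
coeff-0∷-+ f g zero    = refl
coeff-0∷-+ f g (suc i) = coeff-+ f g i

coeff-0∷-scale : ∀ c f i → coeff (0ℚ ∷ scale c f) i ≡ c *ℚ coeff (0ℚ ∷ f) i
coeff-0∷-scale c f zero    = sym (ℚₚ.*-zeroʳ c)
coeff-0∷-scale c f (suc i) = coeff-scale c f i

-- Leaving `0ℚ ∷ f *ₚ g` unsplit expresses one step of the convolution for `i = 0` and `i > 0` at
-- once; the inductions on a left factor below rest on it.
coeff-∷-* : ∀ a f g i → coeff ((a ∷ f) *ₚ g) i ≡ a *ℚ coeff g i +ℚ coeff (0ℚ ∷ f *ₚ g) i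
coeff-∷-* a f g i = trans (coeff-+ (scale a g) _ i) (cong (_+ℚ coeff (0ℚ ∷ f *ₚ g) i) (coeff-scale a g i))

coeff-∷-*-0 : ∀ a f g → coeff ((a ∷ f) *ₚ g) 0 ≡ a *ℚ coeff g 0
coeff-∷-*-0 a f g = trans (coeff-∷-* a f g 0) (ℚₚ.+-identityʳ _)

coeff-*-0 : ∀ f g → coeff (f *ₚ g) 0 ≡ coeff f 0 *ℚ coeff g 0
coeff-*-0 []      g = sym (ℚₚ.*-zeroˡ (coeff g 0))
coeff-*-0 (a ∷ f) g = coeff-∷-*-0 a f g

*ₚ-zeroʳ : ∀ f → f *ₚ [] ≈ₚ []
*ₚ-zeroʳ []      i = refl
*ₚ-zeroʳ (a ∷ f) i = trans (coeff-∷-* a f [] i) (cong₂ _+ℚ_ (ℚₚ.*-zeroʳ a) (0∷-[] (*ₚ-zeroʳ f) i))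

*ₚ-congˡ : ∀ f {g h} → g ≈ₚ h → f *ₚ g ≈ₚ f *ₚ h
*ₚ-congˡ []      g≈h i = refl
*ₚ-congˡ (a ∷ f) {g} {h} g≈h i = trans (coeff-∷-* a f g i)
  (trans (cong₂ _+ℚ_ (cong (a *ℚ_) (g≈h i)) (∷-cong refl (*ₚ-congˡ f g≈h) i)) (sym (coeff-∷-* a f h i)))

-- The product is defined by recursion on its left factor. This is the same recursion for the right
-- factor, and commutativity follows by comparing the two.
*ₚ-∷ : ∀ f b g i → coeff (f *ₚ (b ∷ g)) i ≡ b *ℚ coeff f i +ℚ coeff (0ℚ ∷ f *ₚ g) i
*ₚ-∷ []      b g i = sym (cong₂ _+ℚ_ (ℚₚ.*-zeroʳ b) (0∷-[] {[]} (λ _ → refl) i))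
*ₚ-∷ (a ∷ f) b g zero = trans (coeff-∷-*-0 a f (b ∷ g)) (trans (ℚₚ.*-comm a b) (sym (ℚₚ.+-identityʳ _)))
*ₚ-∷ (a ∷ f) b g (suc i) = begin
  coeff ((a ∷ f) *ₚ (b ∷ g)) (suc i)                                   ≡⟨ coeff-∷-* a f (b ∷ g) (suc i) ⟩
  a *ℚ coeff g i +ℚ coeff (f *ₚ (b ∷ g)) i                             ≡⟨ cong (a *ℚ coeff g i +ℚ_) (*ₚ-∷ f b g i) ⟩
  a *ℚ coeff g i +ℚ (b *ℚ coeff f i +ℚ coeff (0ℚ ∷ f *ₚ g) i)          ≡⟨ solve 3 (λ x y z → x :+ (y :+ z) := y :+ (x :+ z)) refl (a *ℚ coeff g i) (b *ℚ coeff f i) (coeff (0ℚ ∷ f *ₚ g) i) ⟩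
  b *ℚ coeff f i +ℚ (a *ℚ coeff g i +ℚ coeff (0ℚ ∷ f *ₚ g) i)          ≡⟨ cong (b *ℚ coeff f i +ℚ_) (coeff-∷-* a f g i) ⟨
  b *ℚ coeff f i +ℚ coeff ((a ∷ f) *ₚ g) i                             ∎
  where open ≡-Reasoning

*ₚ-comm : ∀ f g → f *ₚ g ≈ₚ g *ₚ f
*ₚ-comm []      g i = sym (*ₚ-zeroʳ g i)
*ₚ-comm (a ∷ f) g i = trans (coeff-∷-* a f g i)
  (trans (cong (a *ℚ coeff g i +ℚ_) (∷-cong refl (*ₚ-comm f g) i)) (sym (*ₚ-∷ g a f i)))

*ₚ-zeroˡ : ∀ f g → f ≈ₚ [] → f *ₚ g ≈ₚ []
*ₚ-zeroˡ f g f≈[] i = trans (*ₚ-comm f g i) (trans (*ₚ-congˡ g f≈[] i) (*ₚ-zeroʳ g i))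

coeff-scale-* : ∀ c f g i → coeff (scale c f *ₚ g) i ≡ c *ℚ coeff (f *ₚ g) i
coeff-scale-* c []      g i = sym (ℚₚ.*-zeroʳ c)
coeff-scale-* c (a ∷ f) g i = begin
  coeff ((c *ℚ a ∷ scale c f) *ₚ g) i                                ≡⟨ coeff-∷-* (c *ℚ a) (scale c f) g i ⟩
  c *ℚ a *ℚ coeff g i +ℚ coeff (0ℚ ∷ scale c f *ₚ g) i               ≡⟨ cong (c *ℚ a *ℚ coeff g i +ℚ_) (trans (∷-cong refl (λ j → trans (coeff-scale-* c f g j) (sym (coeff-scale c (f *ₚ g) j))) i) (coeff-0∷-scale c (f *ₚ g) i)) ⟩
  c *ℚ a *ℚ coeff g i +ℚ c *ℚ coeff (0ℚ ∷ f *ₚ g) i                  ≡⟨ solve 4 (λ c a x y → c :* a :* x :+ c :* y := c :* (a :* x :+ y)) refl c a (coeff g i) (coeff (0ℚ ∷ f *ₚ g) i) ⟩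
  c *ℚ (a *ℚ coeff g i +ℚ coeff (0ℚ ∷ f *ₚ g) i)                     ≡⟨ cong (c *ℚ_) (coeff-∷-* a f g i) ⟨
  c *ℚ coeff ((a ∷ f) *ₚ g) i                                        ∎
  where open ≡-Reasoning

coeff-*-scale : ∀ c f g i → coeff (f *ₚ scale c g) i ≡ c *ℚ coeff (f *ₚ g) i
coeff-*-scale c f g i = trans (*ₚ-comm f (scale c g) i)
  (trans (coeff-scale-* c g f i) (cong (c *ℚ_) (*ₚ-comm g f i)))

coeff-+-* : ∀ f g h i → coeff ((f +ₚ g) *ₚ h) i ≡ coeff (f *ₚ h) i +ℚ coeff (g *ₚ h) i
coeff-+-* []      g       h i = sym (ℚₚ.+-identityˡ _)
coeff-+-* (a ∷ f) []      h i = sym (ℚₚ.+-identityʳ _)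
coeff-+-* (a ∷ f) (b ∷ g) h i = begin
  coeff ((a +ℚ b ∷ (f +ₚ g)) *ₚ h) i
    ≡⟨ coeff-∷-* (a +ℚ b) (f +ₚ g) h i ⟩
  (a +ℚ b) *ℚ coeff h i +ℚ coeff (0ℚ ∷ (f +ₚ g) *ₚ h) i
    ≡⟨ cong ((a +ℚ b) *ℚ coeff h i +ℚ_) (trans (∷-cong refl (λ j → trans (coeff-+-* f g h j) (sym (coeff-+ (f *ₚ h) (g *ₚ h) j))) i) (coeff-0∷-+ (f *ₚ h) (g *ₚ h) i)) ⟩
  (a +ℚ b) *ℚ coeff h i +ℚ (coeff (0ℚ ∷ f *ₚ h) i +ℚ coeff (0ℚ ∷ g *ₚ h) i)
    ≡⟨ solve 5 (λ a b x y z → (a :+ b) :* x :+ (y :+ z) := (a :* x :+ y) :+ (b :* x :+ z)) refl a b (coeff h i) (coeff (0ℚ ∷ f *ₚ h) i) (coeff (0ℚ ∷ g *ₚ h) i) ⟩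
  (a *ℚ coeff h i +ℚ coeff (0ℚ ∷ f *ₚ h) i) +ℚ (b *ℚ coeff h i +ℚ coeff (0ℚ ∷ g *ₚ h) i)
    ≡⟨ cong₂ _+ℚ_ (coeff-∷-* a f h i) (coeff-∷-* b g h i) ⟨
  coeff ((a ∷ f) *ₚ h) i +ℚ coeff ((b ∷ g) *ₚ h) i ∎
  where open ≡-Reasoning

-- Degree

HasDeg : Poly → ℕ → Set
HasDeg f d = DegLe f d × ¬ (coeff f d ≡ 0ℚ)

-- Lists may end in zeros, so their length does not give the degree; the zero test on ℚ is applied
-- from the last coefficient inwards.
≈[]-or-HasDeg : ∀ f → (f ≈ₚ []) ⊎ ∃ (HasDeg f)
≈[]-or-HasDeg [] = inj₁ λ _ → refl
≈[]-or-HasDeg (a ∷ f) with ≈[]-or-HasDeg f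
... | inj₂ (d , f≤d , fd≢0) = inj₂ (suc d , (λ { (suc i) (s≤s d<i) → f≤d i d<i }) , fd≢0)
... | inj₁ f≈[] with a ℚₚ.≟ 0ℚ
...   | yes refl = inj₁ (0∷-[] f≈[])
...   | no a≢0   = inj₂ (0 , (λ { (suc i) _ → f≈[] i }) , a≢0)

DegLe-0 : ∀ {a f} → DegLe (a ∷ f) 0 → f ≈ₚ []
DegLe-0 f≤0 i = f≤0 (suc i) (s≤s z≤n)

DegLe-suc : ∀ {a f d} → DegLe (a ∷ f) (suc d) → DegLe f d
DegLe-suc f≤d i d<i = f≤d (suc i) (s≤s d<i)

DegLe-scale : ∀ c {f d} → DegLe f d → DegLe (scale c f) d
DegLe-scale c {f} f≤d i d<i = trans (coeff-scale c f i) (trans (cong (c *ℚ_) (f≤d i d<i)) (ℚₚ.*-zeroʳ c))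

DegLe-* : ∀ f {g a b} → DegLe f a → DegLe g b → DegLe (f *ₚ g) (a + b)
DegLe-* []      f≤a g≤b i lt = refl
DegLe-* (c ∷ f) {g} {zero} {b} f≤a g≤b i lt = trans (coeff-∷-* c f g i)
  (cong₂ _+ℚ_ (trans (cong (c *ℚ_) (g≤b i lt)) (ℚₚ.*-zeroʳ c)) (0∷-[] (*ₚ-zeroˡ f g (DegLe-0 {c} f≤a)) i))
DegLe-* (c ∷ f) {g} {suc a} {b} f≤a g≤b (suc i) (s≤s lt) = trans (coeff-∷-* c f g (suc i))
  (cong₂ _+ℚ_ (trans (cong (c *ℚ_) (g≤b (suc i) (s≤s (ℕₚ.≤-trans (ℕₚ.m≤n+m b a) (ℕₚ.<⇒≤ lt))))) (ℚₚ.*-zeroʳ c)) (DegLe-* f (DegLe-suc {c} f≤a) g≤b i lt))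

coeff-*-top : ∀ f {g a b} → DegLe f a → DegLe g b → coeff (f *ₚ g) (a + b) ≡ coeff f a *ℚ coeff g b
coeff-*-top []      {g} {a} {b} f≤a g≤b = sym (ℚₚ.*-zeroˡ (coeff g b))
coeff-*-top (c ∷ f) {g} {zero} {b} f≤a g≤b = trans (coeff-∷-* c f g b)
  (trans (cong (c *ℚ coeff g b +ℚ_) (0∷-[] (*ₚ-zeroˡ f g (DegLe-0 {c} f≤a)) b)) (ℚₚ.+-identityʳ _))
coeff-*-top (c ∷ f) {g} {suc a} {b} f≤a g≤b = trans (coeff-∷-* c f g (suc (a + b)))
  (trans (cong₂ _+ℚ_ (trans (cong (c *ℚ_) (g≤b (suc (a + b)) (s≤s (ℕₚ.m≤n+m b a)))) (ℚₚ.*-zeroʳ c)) (coeff-*-top f (DegLe-suc {c} f≤a) g≤b))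
    (ℚₚ.+-identityˡ _))

HasDeg-unique : ∀ {f g a b} → f ≈ₚ g → HasDeg f a → HasDeg g b → a ≡ b
HasDeg-unique {a = a} {b} f≈g (f≤a , fa≢0) (g≤b , gb≢0) with ℕₚ.<-cmp a b
... | tri< a<b _ _ = ⊥-elim (gb≢0 (trans (sym (f≈g b)) (f≤a b a<b)))
... | tri≈ _ a≡b _ = a≡b
... | tri> _ _ b<a = ⊥-elim (fa≢0 (trans (f≈g a) (g≤b a b<a)))

HasDeg-* : ∀ {f g a b} → HasDeg f a → HasDeg g b → HasDeg (f *ₚ g) (a + b)
HasDeg-* {f} (f≤a , fa≢0) (g≤b , gb≢0) =
  DegLe-* f f≤a g≤b , λ eq → *ℚ-≢0 fa≢0 gb≢0 (trans (sym (coeff-*-top f f≤a g≤b)) eq)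

HasDeg-0⇒IsUnit : ∀ {f} → HasDeg f 0 → IsUnit f
HasDeg-0⇒IsUnit {f} (f≤0 , f0≢0) =
  coeff f 0 , f0≢0 , λ { zero → refl ; (suc i) → f≤0 (suc i) (s≤s z≤n) }

-- Taylor shift: f(x) is rewritten as f(y - 1) by Horner's scheme

shift : Poly → Poly
shift []      = []
shift (a ∷ f) = (a ∷ shift f) +ₚ scale (-ℚ 1ℚ) (shift f)

coeff-shift-∷ : ∀ a f i → coeff (shift (a ∷ f)) i ≡ coeff (a ∷ shift f) i +ℚ -ℚ 1ℚ *ℚ coeff (shift f) i
coeff-shift-∷ a f i = trans (coeff-+ (a ∷ shift f) (scale (-ℚ 1ℚ) (shift f)) i)
  (cong (coeff (a ∷ shift f) i +ℚ_) (coeff-scale (-ℚ 1ℚ) (shift f) i))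

shift-[] : ∀ f → f ≈ₚ [] → shift f ≈ₚ []
shift-[] []      f≈[] i = refl
shift-[] (a ∷ f) f≈[] i = trans (coeff-shift-∷ a f i)
  (cong₂ _+ℚ_ (trans (∷-cong (f≈[] 0) (shift-[] f (λ j → f≈[] (suc j))) i) (0∷-[] {[]} (λ _ → refl) i))
    (trans (cong (-ℚ 1ℚ *ℚ_) (shift-[] f (λ j → f≈[] (suc j)) i)) (ℚₚ.*-zeroʳ (-ℚ 1ℚ))))

shift-cong : ∀ f g → f ≈ₚ g → shift f ≈ₚ shift g
shift-cong []      g       f≈g i = sym (shift-[] g (λ j → sym (f≈g j)) i)
shift-cong (a ∷ f) []      f≈g i = shift-[] (a ∷ f) f≈g i
shift-cong (a ∷ f) (b ∷ g) f≈g i = begin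
  coeff (shift (a ∷ f)) i                                       ≡⟨ coeff-shift-∷ a f i ⟩
  coeff (a ∷ shift f) i +ℚ -ℚ 1ℚ *ℚ coeff (shift f) i           ≡⟨ cong₂ (λ x y → x +ℚ -ℚ 1ℚ *ℚ y) (∷-cong (f≈g 0) eq i) (eq i) ⟩
  coeff (b ∷ shift g) i +ℚ -ℚ 1ℚ *ℚ coeff (shift g) i           ≡⟨ coeff-shift-∷ b g i ⟨
  coeff (shift (b ∷ g)) i                                       ∎
  where
  open ≡-Reasoning
  eq : shift f ≈ₚ shift g
  eq = shift-cong f g (λ j → f≈g (suc j))

coeff-shift-+ : ∀ f g i → coeff (shift (f +ₚ g)) i ≡ coeff (shift f) i +ℚ coeff (shift g) i
coeff-shift-+ []      g       i = sym (ℚₚ.+-identityˡ _)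
coeff-shift-+ (a ∷ f) []      i = sym (ℚₚ.+-identityʳ _)
coeff-shift-+ (a ∷ f) (b ∷ g) i = begin
  coeff (shift (a +ℚ b ∷ (f +ₚ g))) i
    ≡⟨ coeff-shift-∷ (a +ℚ b) (f +ₚ g) i ⟩
  coeff (a +ℚ b ∷ shift (f +ₚ g)) i +ℚ -ℚ 1ℚ *ℚ coeff (shift (f +ₚ g)) i
    ≡⟨ cong₂ (λ x y → x +ℚ -ℚ 1ℚ *ℚ y)
         (trans (∷-cong refl (λ j → trans (coeff-shift-+ f g j) (sym (coeff-+ (shift f) (shift g) j))) i) (coeff-+ (a ∷ shift f) (b ∷ shift g) i))
         (coeff-shift-+ f g i) ⟩
  coeff (a ∷ shift f) i +ℚ coeff (b ∷ shift g) i +ℚ -ℚ 1ℚ *ℚ (coeff (shift f) i +ℚ coeff (shift g) i)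
    ≡⟨ solve 5 (λ x y z w k → x :+ y :+ k :* (z :+ w) := (x :+ k :* z) :+ (y :+ k :* w)) refl (coeff (a ∷ shift f) i) (coeff (b ∷ shift g) i) (coeff (shift f) i) (coeff (shift g) i) (-ℚ 1ℚ) ⟩
  (coeff (a ∷ shift f) i +ℚ -ℚ 1ℚ *ℚ coeff (shift f) i) +ℚ (coeff (b ∷ shift g) i +ℚ -ℚ 1ℚ *ℚ coeff (shift g) i)
    ≡⟨ cong₂ _+ℚ_ (coeff-shift-∷ a f i) (coeff-shift-∷ b g i) ⟨
  coeff (shift (a ∷ f)) i +ℚ coeff (shift (b ∷ g)) i ∎
  where open ≡-Reasoning

coeff-shift-scale : ∀ c f i → coeff (shift (scale c f)) i ≡ c *ℚ coeff (shift f) i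
coeff-shift-scale c []      i = sym (ℚₚ.*-zeroʳ c)
coeff-shift-scale c (a ∷ f) i = begin
  coeff (shift (c *ℚ a ∷ scale c f)) i
    ≡⟨ coeff-shift-∷ (c *ℚ a) (scale c f) i ⟩
  coeff (c *ℚ a ∷ shift (scale c f)) i +ℚ -ℚ 1ℚ *ℚ coeff (shift (scale c f)) i
    ≡⟨ cong₂ (λ x y → x +ℚ -ℚ 1ℚ *ℚ y)
         (trans (∷-cong refl (λ j → trans (coeff-shift-scale c f j) (sym (coeff-scale c (shift f) j))) i) (coeff-scale c (a ∷ shift f) i))
         (coeff-shift-scale c f i) ⟩
  c *ℚ coeff (a ∷ shift f) i +ℚ -ℚ 1ℚ *ℚ (c *ℚ coeff (shift f) i)
    ≡⟨ solve 4 (λ c x y k → c :* x :+ k :* (c :* y) := c :* (x :+ k :* y)) refl c (coeff (a ∷ shift f) i) (coeff (shift f) i) (-ℚ 1ℚ) ⟩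
  c *ℚ (coeff (a ∷ shift f) i +ℚ -ℚ 1ℚ *ℚ coeff (shift f) i)
    ≡⟨ cong (c *ℚ_) (coeff-shift-∷ a f i) ⟨
  c *ℚ coeff (shift (a ∷ f)) i ∎
  where open ≡-Reasoning

-- Substitution is a ring homomorphism, so a factorisation in x becomes one in y. In the induction,
-- multiplication by x on the left corresponds to multiplication by y - 1 on the right.
shift-* : ∀ f g → shift (f *ₚ g) ≈ₚ shift f *ₚ shift g
shift-* []      g i = refl
shift-* (a ∷ f) g i = begin
  coeff (shift (scale a g +ₚ (0ℚ ∷ f *ₚ g))) i
    ≡⟨ coeff-shift-+ (scale a g) (0ℚ ∷ f *ₚ g) i ⟩
  coeff (shift (scale a g)) i +ℚ coeff (shift (0ℚ ∷ f *ₚ g)) i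
    ≡⟨ cong₂ _+ℚ_ (coeff-shift-scale a g i) (coeff-shift-∷ 0ℚ (f *ₚ g) i) ⟩
  a *ℚ coeff (shift g) i +ℚ (coeff (0ℚ ∷ shift (f *ₚ g)) i +ℚ -ℚ 1ℚ *ℚ coeff (shift (f *ₚ g)) i)
    ≡⟨ cong₂ (λ x y → a *ℚ coeff (shift g) i +ℚ (x +ℚ -ℚ 1ℚ *ℚ y)) (∷-cong refl (shift-* f g) i) (shift-* f g i) ⟩
  a *ℚ coeff (shift g) i +ℚ (coeff (0ℚ ∷ shift f *ₚ shift g) i +ℚ -ℚ 1ℚ *ℚ coeff (shift f *ₚ shift g) i)
    ≡⟨ ℚₚ.+-assoc (a *ℚ coeff (shift g) i) _ _ ⟨
  a *ℚ coeff (shift g) i +ℚ coeff (0ℚ ∷ shift f *ₚ shift g) i +ℚ -ℚ 1ℚ *ℚ coeff (shift f *ₚ shift g) i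
    ≡⟨ cong₂ _+ℚ_ (coeff-∷-* a (shift f) (shift g) i) (coeff-scale-* (-ℚ 1ℚ) (shift f) (shift g) i) ⟨
  coeff ((a ∷ shift f) *ₚ shift g) i +ℚ coeff (scale (-ℚ 1ℚ) (shift f) *ₚ shift g) i
    ≡⟨ coeff-+-* (a ∷ shift f) (scale (-ℚ 1ℚ) (shift f)) (shift g) i ⟨
  coeff (shift (a ∷ f) *ₚ shift g) i ∎
  where open ≡-Reasoning

DegLe-shift : ∀ f {d} → DegLe f d → DegLe (shift f) d
DegLe-shift []      f≤d i lt = refl
DegLe-shift (a ∷ f) {zero}  f≤d (suc i) lt = trans (coeff-shift-∷ a f (suc i))
  (cong₂ (λ x y → x +ℚ -ℚ 1ℚ *ℚ y) (shift-[] f (DegLe-0 {a} f≤d) i) (shift-[] f (DegLe-0 {a} f≤d) (suc i)))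
DegLe-shift (a ∷ f) {suc d} f≤d (suc i) (s≤s lt) = trans (coeff-shift-∷ a f (suc i))
  (cong₂ (λ x y → x +ℚ -ℚ 1ℚ *ℚ y) (DegLe-shift f (DegLe-suc {a} f≤d) i lt) (DegLe-shift f (DegLe-suc {a} f≤d) (suc i) (ℕₚ.m<n⇒m<1+n lt)))

-- `derivAux k` is the operator x d/dx + k, so raising `k` by one adds the identity operator; at k =
-- 0 it is x d/dx.
derivAux-suc : ∀ k f → derivAux (suc k) f ≈ₚ f +ₚ derivAux k f
derivAux-suc k f i = begin
  coeff (derivAux (suc k) f) i                  ≡⟨ coeff-derivAux (suc k) f i ⟩
  ℕtoℚ (suc (k + i)) *ℚ coeff f i               ≡⟨ cong (_*ℚ coeff f i) (ℕtoℚ-suc (k + i)) ⟩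
  (1ℚ +ℚ ℕtoℚ (k + i)) *ℚ coeff f i             ≡⟨ solve 2 (λ x y → (con 1ℚ :+ x) :* y := y :+ x :* y) refl (ℕtoℚ (k + i)) (coeff f i) ⟩
  coeff f i +ℚ ℕtoℚ (k + i) *ℚ coeff f i        ≡⟨ cong (coeff f i +ℚ_) (coeff-derivAux k f i) ⟨
  coeff f i +ℚ coeff (derivAux k f) i           ≡⟨ coeff-+ f (derivAux k f) i ⟨
  coeff (f +ₚ derivAux k f) i                   ∎
  where open ≡-Reasoning

derivAux-0 : ∀ f → derivAux 0 f ≈ₚ 0ℚ ∷ deriv f
derivAux-0 f zero    = trans (coeff-derivAux 0 f 0) (ℚₚ.*-zeroˡ (coeff f 0))
derivAux-0 f (suc i) = trans (coeff-derivAux 0 f (suc i)) (sym (coeff-deriv f i))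

-- In the variable y = x + 1, the operator (1 + x) d/dx + k becomes the diagonal operator y d/dy + k.
shift-deriv : ∀ k f → shift (deriv f +ₚ derivAux k f) ≈ₚ derivAux k (shift f)
shift-deriv k [] i = refl
shift-deriv k (a ∷ f) i = begin
  coeff (shift (derivAux 1 f +ₚ (ℕtoℚ k *ℚ a ∷ derivAux (suc k) f))) i
    ≡⟨ coeff-shift-+ (derivAux 1 f) _ i ⟩
  coeff (shift (derivAux 1 f)) i +ℚ coeff (shift (ℕtoℚ k *ℚ a ∷ derivAux (suc k) f)) i
    ≡⟨ cong₂ _+ℚ_ (derivAux-1 i) (trans (coeff-shift-∷ (ℕtoℚ k *ℚ a) (derivAux (suc k) f) i) (cong₂ (λ x y → x +ℚ -ℚ 1ℚ *ℚ y) (∷-cong refl (λ j → trans (derivAux-1+k j) (sym (coeff-+ s A j))) i) (derivAux-1+k i))) ⟩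
  coeff s i +ℚ (coeff (0ℚ ∷ D) i +ℚ -ℚ 1ℚ *ℚ coeff D i) +ℚ (coeff (ℕtoℚ k *ℚ a ∷ (s +ₚ A)) i +ℚ -ℚ 1ℚ *ℚ (coeff s i +ℚ coeff A i))
    ≡⟨ solve 5 (λ s d D x A → s :+ (d :+ con (-ℚ 1ℚ) :* D) :+ (x :+ con (-ℚ 1ℚ) :* (s :+ A)) := d :+ x :+ con (-ℚ 1ℚ) :* (D :+ A)) refl (coeff s i) (coeff (0ℚ ∷ D) i) (coeff D i) (coeff (ℕtoℚ k *ℚ a ∷ (s +ₚ A)) i) (coeff A i) ⟩
  coeff (0ℚ ∷ D) i +ℚ coeff (ℕtoℚ k *ℚ a ∷ (s +ₚ A)) i +ℚ -ℚ 1ℚ *ℚ (coeff D i +ℚ coeff A i)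
    ≡⟨ cong₂ (λ x y → x +ℚ -ℚ 1ℚ *ℚ y) (upper i) (IH i) ⟩
  ℕtoℚ (k + i) *ℚ coeff (a ∷ s) i +ℚ -ℚ 1ℚ *ℚ (ℕtoℚ (k + i) *ℚ coeff s i)
    ≡⟨ solve 3 (λ k x y → k :* x :+ con (-ℚ 1ℚ) :* (k :* y) := k :* (x :+ con (-ℚ 1ℚ) :* y)) refl (ℕtoℚ (k + i)) (coeff (a ∷ s) i) (coeff s i) ⟩
  ℕtoℚ (k + i) *ℚ (coeff (a ∷ s) i +ℚ -ℚ 1ℚ *ℚ coeff s i)
    ≡⟨ cong (ℕtoℚ (k + i) *ℚ_) (coeff-shift-∷ a f i) ⟨
  ℕtoℚ (k + i) *ℚ coeff (shift (a ∷ f)) i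
    ≡⟨ coeff-derivAux k (shift (a ∷ f)) i ⟨
  coeff (derivAux k (shift (a ∷ f))) i ∎
  where
  open ≡-Reasoning
  s D A : Poly
  s = shift f
  D = shift (deriv f)
  A = shift (derivAux k f)

  IH : ∀ j → coeff D j +ℚ coeff A j ≡ ℕtoℚ (k + j) *ℚ coeff s j
  IH j = trans (sym (coeff-shift-+ (deriv f) (derivAux k f) j)) (trans (shift-deriv k f j) (coeff-derivAux k s j))

  derivAux-1+k : ∀ j → coeff (shift (derivAux (suc k) f)) j ≡ coeff s j +ℚ coeff A j
  derivAux-1+k j = trans (shift-cong (derivAux (suc k) f) (f +ₚ derivAux k f) (derivAux-suc k f) j) (coeff-shift-+ f (derivAux k f) j)

  -- This is f + x f' rewritten in y, where the factor x turns into y - 1.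
  derivAux-1 : ∀ j → coeff (shift (derivAux 1 f)) j ≡ coeff s j +ℚ (coeff (0ℚ ∷ D) j +ℚ -ℚ 1ℚ *ℚ coeff D j)
  derivAux-1 j = trans (shift-cong (derivAux 1 f) (f +ₚ derivAux 0 f) (derivAux-suc 0 f) j)
    (trans (coeff-shift-+ f (derivAux 0 f) j)
      (cong (coeff s j +ℚ_) (trans (shift-cong (derivAux 0 f) (0ℚ ∷ deriv f) (derivAux-0 f) j) (coeff-shift-∷ 0ℚ (deriv f) j))))

  upper : ∀ j → coeff (0ℚ ∷ D) j +ℚ coeff (ℕtoℚ k *ℚ a ∷ (s +ₚ A)) j ≡ ℕtoℚ (k + j) *ℚ coeff (a ∷ s) j
  upper zero = trans (ℚₚ.+-identityˡ _) (cong (λ l → ℕtoℚ l *ℚ a) (sym (ℕₚ.+-identityʳ k)))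
  upper (suc j) = begin
    coeff D j +ℚ coeff (s +ₚ A) j                  ≡⟨ cong (coeff D j +ℚ_) (coeff-+ s A j) ⟩
    coeff D j +ℚ (coeff s j +ℚ coeff A j)          ≡⟨ solve 3 (λ x y z → x :+ (y :+ z) := y :+ (x :+ z)) refl (coeff D j) (coeff s j) (coeff A j) ⟩
    coeff s j +ℚ (coeff D j +ℚ coeff A j)          ≡⟨ cong (coeff s j +ℚ_) (IH j) ⟩
    coeff s j +ℚ ℕtoℚ (k + j) *ℚ coeff s j         ≡⟨ solve 2 (λ x y → y :+ x :* y := (con 1ℚ :+ x) :* y) refl (ℕtoℚ (k + j)) (coeff s j) ⟩
    (1ℚ +ℚ ℕtoℚ (k + j)) *ℚ coeff s j              ≡⟨ cong (_*ℚ coeff s j) (trans (cong ℕtoℚ (ℕₚ.+-suc k j)) (ℕtoℚ-suc (k + j))) ⟨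
    ℕtoℚ (k + suc j) *ℚ coeff s j                  ∎

monomial : ℕ → ℚ → Poly
monomial zero    c = c ∷ []
monomial (suc m) c = 0ℚ ∷ monomial m c

coeff-monomial : ∀ m c → coeff (monomial m c) m ≡ c
coeff-monomial zero    c = refl
coeff-monomial (suc m) c = coeff-monomial m c

DegLe-monomial : ∀ m c → DegLe (monomial m c) m
DegLe-monomial zero    c (suc i) lt       = refl
DegLe-monomial (suc m) c (suc i) (s≤s lt) = DegLe-monomial m c i lt

coeff-monomial-< : ∀ m c i → i < m → coeff (monomial m c) i ≡ 0ℚ
coeff-monomial-< (suc m) c zero    lt       = refl
coeff-monomial-< (suc m) c (suc i) (s≤s lt) = coeff-monomial-< m c i lt

-- The constant term of c (y - 1)^m is c up to sign. Only its being a p-adic unit matters later, so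
-- one sign change per factor is enough.
coeff-shift-monomial-0 : ∀ m c → coeff (shift (monomial (suc m) c)) 0 ≡ -ℚ coeff (shift (monomial m c)) 0
coeff-shift-monomial-0 m c = trans (coeff-shift-∷ 0ℚ (monomial m c) 0)
  (solve 1 (λ x → con 0ℚ :+ con (-ℚ 1ℚ) :* x := :- x) refl (coeff (shift (monomial m c)) 0))

coeff-shift-monomial-top : ∀ m c → coeff (shift (monomial m c)) m ≡ c
coeff-shift-monomial-top zero    c = trans (coeff-shift-∷ c [] 0) (ℚₚ.+-identityʳ c)
coeff-shift-monomial-top (suc m) c = trans (coeff-shift-∷ 0ℚ (monomial m c) (suc m))
  (trans (cong₂ (λ x y → x +ℚ -ℚ 1ℚ *ℚ y) (coeff-shift-monomial-top m c) (DegLe-shift (monomial m c) (DegLe-monomial m c) (suc m) ℕₚ.≤-refl))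
    (ℚₚ.+-identityʳ c))

-- Gauss's lemma and Eisenstein's criterion over ℤ₍ₚ₎

module Localisation {p : ℕ} (p-prime : Prime p) where

  p∤1 : ¬ p ∣ 1
  p∤1 = >⇒∤ (ℕ.nonTrivial⇒n>1 p {{prime⇒nonTrivial p-prime}})

  p∤* : ∀ {a b} → ¬ p ∣ a → ¬ p ∣ b → ¬ p ∣ a * b
  p∤* {a} {b} p∤a p∤b p∣ab = [ p∤a , p∤b ]′ (euclidsLemma a b p-prime p∣ab)

  pℚ : ℚ
  pℚ = ℕtoℚ p

  pℚ≢0 : ¬ (pℚ ≡ 0ℚ)
  pℚ≢0 eq = ℕ.≢-nonZero⁻¹ p {{prime⇒nonZero p-prime}} (ℤₚ.+-injective (ι-injective {+ p} {+ 0} eq))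

  -- The local ring ℤ₍ₚ₎, its maximal ideal and its units.
  I M U : ℚ → Set
  I x = ∃ λ d → ∃ λ z → ¬ p ∣ d × ℕtoℚ d *ℚ x ≡ ι z
  M x = ∃ λ y → I y × x ≡ pℚ *ℚ y
  U x = I x × ¬ M x

  I-ι : ∀ z → I (ι z)
  I-ι z = 1 , z , p∤1 , ℚₚ.*-identityˡ (ι z)

  I-+ : ∀ {x y} → I x → I y → I (x +ℚ y)
  I-+ {x} {y} (d , z , p∤d , dx≡z) (d′ , z′ , p∤d′ , dy≡z′) =
    d * d′ , + d′ ℤ.* z ℤ.+ + d ℤ.* z′ , p∤* p∤d p∤d′ , (begin
      ℕtoℚ (d * d′) *ℚ (x +ℚ y)
        ≡⟨ cong (_*ℚ (x +ℚ y)) (ℕtoℚ-* d d′) ⟩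
      ℕtoℚ d *ℚ ℕtoℚ d′ *ℚ (x +ℚ y)
        ≡⟨ solve 4 (λ d d′ x y → d :* d′ :* (x :+ y) := d′ :* (d :* x) :+ d :* (d′ :* y)) refl (ℕtoℚ d) (ℕtoℚ d′) x y ⟩
      ℕtoℚ d′ *ℚ (ℕtoℚ d *ℚ x) +ℚ ℕtoℚ d *ℚ (ℕtoℚ d′ *ℚ y)
        ≡⟨ cong₂ (λ s t → ℕtoℚ d′ *ℚ s +ℚ ℕtoℚ d *ℚ t) dx≡z dy≡z′ ⟩
      ℕtoℚ d′ *ℚ ι z +ℚ ℕtoℚ d *ℚ ι z′
        ≡⟨ cong₂ _+ℚ_ (ι-* (+ d′) z) (ι-* (+ d) z′) ⟨
      ι (+ d′ ℤ.* z) +ℚ ι (+ d ℤ.* z′)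
        ≡⟨ ι-+ (+ d′ ℤ.* z) (+ d ℤ.* z′) ⟨
      ι (+ d′ ℤ.* z ℤ.+ + d ℤ.* z′) ∎)
    where open ≡-Reasoning

  -- Separate from `I-*` because `M-prime` needs precisely this denominator and numerator for the
  -- product.
  *-fractions : ∀ {x y} d z d′ z′ → ℕtoℚ d *ℚ x ≡ ι z → ℕtoℚ d′ *ℚ y ≡ ι z′ → ℕtoℚ (d * d′) *ℚ (x *ℚ y) ≡ ι (z ℤ.* z′)
  *-fractions {x} {y} d z d′ z′ dx≡z dy≡z′ = begin
    ℕtoℚ (d * d′) *ℚ (x *ℚ y)              ≡⟨ cong (_*ℚ (x *ℚ y)) (ℕtoℚ-* d d′) ⟩
    ℕtoℚ d *ℚ ℕtoℚ d′ *ℚ (x *ℚ y)          ≡⟨ solve 4 (λ d d′ x y → d :* d′ :* (x :* y) := d :* x :* (d′ :* y)) refl (ℕtoℚ d) (ℕtoℚ d′) x y ⟩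
    ℕtoℚ d *ℚ x *ℚ (ℕtoℚ d′ *ℚ y)          ≡⟨ cong₂ _*ℚ_ dx≡z dy≡z′ ⟩
    ι z *ℚ ι z′                            ≡⟨ ι-* z z′ ⟨
    ι (z ℤ.* z′)                           ∎
    where open ≡-Reasoning

  I-* : ∀ {x y} → I x → I y → I (x *ℚ y)
  I-* (d , z , p∤d , dx≡z) (d′ , z′ , p∤d′ , dy≡z′) =
    d * d′ , z ℤ.* z′ , p∤* p∤d p∤d′ , *-fractions d z d′ z′ dx≡z dy≡z′

  M⇒I : ∀ {x} → M x → I x
  M⇒I (y , Iy , refl) = I-* (I-ι (+ p)) Iy

  M-0 : M 0ℚ
  M-0 = 0ℚ , I-ι (+ 0) , sym (ℚₚ.*-zeroʳ pℚ)

  M-+ : ∀ {x y} → M x → M y → M (x +ℚ y)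
  M-+ (x , Ix , refl) (y , Iy , refl) = x +ℚ y , I-+ Ix Iy , sym (ℚₚ.*-distribˡ-+ pℚ x y)

  M-*ˡ : ∀ {x y} → I x → M y → M (x *ℚ y)
  M-*ˡ {x} Ix (y , Iy , refl) = x *ℚ y , I-* Ix Iy ,
    solve 3 (λ p x y → x :* (p :* y) := p :* (x :* y)) refl pℚ x y

  M-*ʳ : ∀ {x y} → M x → I y → M (x *ℚ y)
  M-*ʳ {x} {y} Mx Iy = subst M (ℚₚ.*-comm y x) (M-*ˡ Iy Mx)

  M-cancel-+ : ∀ {x y} → M (x +ℚ y) → M x → M y
  M-cancel-+ {x} {y} Mx+y Mx =
    subst M (solve 2 (λ x y → x :+ y :+ con (-ℚ 1ℚ) :* x := y) refl x y) (M-+ Mx+y (M-*ˡ (I-ι (ℤ.- + 1)) Mx))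

  -- Cross-multiplying the two fractions gives d′ z = p d z′, and p does not divide d′. Membership
  -- in `M` can thus be read off from any p-integral fraction, which makes it decidable and reduces
  -- `M-prime` to Euclid's lemma on numerators.
  M⇒p∣numerator : ∀ {x} d z → ℕtoℚ d *ℚ x ≡ ι z → M x → p ∣ ∣ z ∣
  M⇒p∣numerator d z dx≡z (y , (d′ , z′ , p∤d′ , d′y≡z′) , refl) =
    [ (λ p∣d′ → ⊥-elim (p∤d′ p∣d′)) , (λ p∣z → p∣z) ]′ (euclidsLemma d′ ∣ z ∣ p-prime p∣d′z)
    where
    open ≡-Reasoning
    d′z≡pdz′ : + d′ ℤ.* z ≡ + p ℤ.* (+ d ℤ.* z′)
    d′z≡pdz′ = ι-injective (begin
      ι (+ d′ ℤ.* z)                            ≡⟨ ι-* (+ d′) z ⟩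
      ℕtoℚ d′ *ℚ ι z                            ≡⟨ cong (ℕtoℚ d′ *ℚ_) dx≡z ⟨
      ℕtoℚ d′ *ℚ (ℕtoℚ d *ℚ (pℚ *ℚ y))          ≡⟨ solve 4 (λ d d′ p y → d′ :* (d :* (p :* y)) := p :* (d :* (d′ :* y))) refl (ℕtoℚ d) (ℕtoℚ d′) pℚ y ⟩
      pℚ *ℚ (ℕtoℚ d *ℚ (ℕtoℚ d′ *ℚ y))          ≡⟨ cong (λ t → pℚ *ℚ (ℕtoℚ d *ℚ t)) d′y≡z′ ⟩
      pℚ *ℚ (ℕtoℚ d *ℚ ι z′)                    ≡⟨ cong (pℚ *ℚ_) (ι-* (+ d) z′) ⟨
      pℚ *ℚ ι (+ d ℤ.* z′)                      ≡⟨ ι-* (+ p) (+ d ℤ.* z′) ⟨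
      ι (+ p ℤ.* (+ d ℤ.* z′))                  ∎)

    p∣d′z : p ∣ d′ * ∣ z ∣
    p∣d′z = subst (p ∣_)
      (trans (sym (ℤₚ.abs-* (+ p) (+ d ℤ.* z′))) (trans (cong ∣_∣ (sym d′z≡pdz′)) (ℤₚ.abs-* (+ d′) z)))
      (m∣m*n ∣ + d ℤ.* z′ ∣)

  p∣numerator⇒M : ∀ {x} d z → ¬ p ∣ d → ℕtoℚ d *ℚ x ≡ ι z → p ∣ ∣ z ∣ → M x
  p∣numerator⇒M {x} d z p∤d dx≡z p∣z with ∣ᵤ⇒∣ {+ p} {z} p∣z
  ... | dividesℤ q refl =
    inverse pℚ≢0 *ℚ x , (d , q , p∤d , dx/p≡q) , sym (inverse-cancelʳ pℚ≢0 x)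
    where
    open ≡-Reasoning
    dx/p≡q : ℕtoℚ d *ℚ (inverse pℚ≢0 *ℚ x) ≡ ι q
    dx/p≡q = begin
      ℕtoℚ d *ℚ (inverse pℚ≢0 *ℚ x)      ≡⟨ solve 3 (λ d r x → d :* (r :* x) := r :* (d :* x)) refl (ℕtoℚ d) (inverse pℚ≢0) x ⟩
      inverse pℚ≢0 *ℚ (ℕtoℚ d *ℚ x)      ≡⟨ cong (inverse pℚ≢0 *ℚ_) (trans dx≡z (trans (ι-* q (+ p)) (ℚₚ.*-comm (ι q) pℚ))) ⟩
      inverse pℚ≢0 *ℚ (pℚ *ℚ ι q)        ≡⟨ inverse-cancelˡ pℚ≢0 (ι q) ⟩
      ι q                                ∎

  M-or-¬M : ∀ {x} → I x → M x ⊎ ¬ M x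
  M-or-¬M (d , z , p∤d , dx≡z) with p ∣? ∣ z ∣
  ... | yes p∣z = inj₁ (p∣numerator⇒M d z p∤d dx≡z p∣z)
  ... | no p∤z  = inj₂ λ Mx → p∤z (M⇒p∣numerator d z dx≡z Mx)

  M-prime : ∀ {x y} → I x → I y → M (x *ℚ y) → M x ⊎ M y
  M-prime (d , z , p∤d , dx≡z) (d′ , z′ , p∤d′ , dy≡z′) Mxy =
    [ (λ p∣z → inj₁ (p∣numerator⇒M d z p∤d dx≡z p∣z)) , (λ p∣z′ → inj₂ (p∣numerator⇒M d′ z′ p∤d′ dy≡z′ p∣z′)) ]′
      (euclidsLemma ∣ z ∣ ∣ z′ ∣ p-prime (subst (p ∣_) (ℤₚ.abs-* z z′)
        (M⇒p∣numerator (d * d′) (z ℤ.* z′) (*-fractions d z d′ z′ dx≡z dy≡z′) Mxy)))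

  U-* : ∀ {x y} → U x → U y → U (x *ℚ y)
  U-* (Ix , ¬Mx) (Iy , ¬My) = I-* Ix Iy , λ Mxy → [ ¬Mx , ¬My ]′ (M-prime Ix Iy Mxy)

  U-ι : ∀ {z} → ¬ p ∣ ∣ z ∣ → U (ι z)
  U-ι {z} p∤z = I-ι z , λ Mz → p∤z (M⇒p∣numerator 1 z (ℚₚ.*-identityˡ (ι z)) Mz)

  U-neg : ∀ {x} → U x → U (-ℚ x)
  U-neg {x} Ux = subst U (solve 1 (λ x → con (-ℚ 1ℚ) :* x := :- x) refl x) (U-* (U-ι {ℤ.- + 1} p∤1) Ux)

  M-cancel : ∀ {x y} → U x → I y → M (x *ℚ y) → M y
  M-cancel (Ix , ¬Mx) Iy Mxy = [ (λ Mx → ⊥-elim (¬Mx Mx)) , (λ My → My) ]′ (M-prime Ix Iy Mxy)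

  -- Integrality of `x` is part of the conclusion, since `d` can be moved into the denominator. This
  -- is how dividing by i + 1 in the recurrence stays inside ℤ₍ₚ₎.
  U-cancel : ∀ {x d} → ¬ p ∣ d → U (ℕtoℚ d *ℚ x) → U x
  U-cancel {x} {d} p∤d ((d′ , z , p∤d′ , eq) , ¬Mdx) =
    (d′ * d , z , p∤* p∤d′ p∤d , trans (cong (_*ℚ x) (ℕtoℚ-* d′ d)) (trans (ℚₚ.*-assoc (ℕtoℚ d′) (ℕtoℚ d) x) eq)) ,
    λ Mx → ¬Mdx (M-*ˡ (I-ι (+ d)) Mx)

  -- A product of two elements of `M` is divisible by p². This is the form in which the p² condition
  -- of Eisenstein's criterion is used.
  M-*-exact : ∀ {x y u} → M x → M y → x *ℚ y ≡ pℚ *ℚ u → M u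
  M-*-exact {u = u} (x , Ix , refl) (y , Iy , refl) eq =
    x *ℚ y , I-* Ix Iy , *ℚ-cancelˡ pℚ≢0 (trans (sym eq) (solve 3 (λ p x y → p :* x :* (p :* y) := p :* (p :* (x :* y))) refl pℚ x y))

  AllI AllM : Poly → Set
  AllI f = ∀ i → I (coeff f i)
  AllM f = ∀ i → M (coeff f i)

  AllI-tail : ∀ {a f} → AllI (a ∷ f) → AllI f
  AllI-tail If i = If (suc i)

  AllM-* : ∀ f g → AllM f → AllI g → AllM (f *ₚ g)
  AllM-* []      g Mf Ig i = M-0
  AllM-* (a ∷ f) g Mf Ig i = subst M (sym (coeff-∷-* a f g i)) (M-+ (M-*ʳ (Mf 0) (Ig i)) (shifted i))
    where
    shifted : AllM (0ℚ ∷ f *ₚ g)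
    shifted zero    = M-0
    shifted (suc j) = AllM-* f g (λ l → Mf (suc l)) Ig j

  AllI-shift : ∀ f → AllI f → AllI (shift f)
  AllI-shift []      If i = I-ι (+ 0)
  AllI-shift (a ∷ f) If i = subst I (sym (coeff-shift-∷ a f i)) (I-+ (consed i) (I-* (I-ι (ℤ.- + 1)) (IH i)))
    where
    IH : AllI (shift f)
    IH = AllI-shift f (AllI-tail {a} If)
    consed : AllI (a ∷ shift f)
    consed zero    = If 0
    consed (suc j) = IH j

  -- Modulo p the constant term of `h` is invertible, so the lowest nonzero coefficient of `g` would
  -- reappear in the product. The induction strips coefficients of `g` from the bottom.
  low-coefficients : ∀ g h → AllI g → AllI h → ¬ M (coeff h 0) →
    ∀ m → (∀ i → i < m → M (coeff (g *ₚ h) i)) → ∀ i → i < m → M (coeff g i)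
  low-coefficients []      h Ig Ih ¬Mh₀ m Mgh i i<m = M-0
  low-coefficients (a ∷ g) h Ig Ih ¬Mh₀ (suc m) Mgh = λ where
      zero    _         → Ma
      (suc i) (s≤s i<m) → low-coefficients g h (AllI-tail {a} Ig) Ih ¬Mh₀ m tail i i<m
    where
    Ma : M a
    Ma = [ (λ Ma → Ma) , (λ Mh₀ → ⊥-elim (¬Mh₀ Mh₀)) ]′
      (M-prime (Ig 0) (Ih 0) (subst M (coeff-∷-*-0 a g h) (Mgh 0 (s≤s z≤n))))
    tail : ∀ i → i < m → M (coeff (g *ₚ h) i)
    tail i i<m = M-cancel-+ (subst M (coeff-∷-* a g h (suc i)) (Mgh (suc i) (s≤s i<m))) (M-*ʳ Ma (Ih (suc i)))

  -- Modulo p, `h` has degree exactly `suc b` while the product has smaller degree; degrees add over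
  -- a field, so `g` vanishes.
  high-coefficients : ∀ g h b → AllI g → AllI h → DegLe h (suc b) → ¬ M (coeff h (suc b)) →
    (∀ i → M (coeff (g *ₚ h) (i + suc b))) → AllM g
  high-coefficients []      h b Ig Ih h≤ ¬Mh Mgh i = M-0
  high-coefficients (a ∷ g) h b Ig Ih h≤ ¬Mh Mgh = λ where
      zero    → [ (λ Ma → Ma) , (λ Mh → ⊥-elim (¬Mh Mh)) ]′ (M-prime (Ig 0) (Ih (suc b)) Mah)
      (suc i) → Mg i
    where
    -- The tail is treated before the head: above degree `suc b` the head `a` only meets vanishing
    -- coefficients of `h`.
    Mg : AllM g
    Mg = high-coefficients g h b (AllI-tail {a} Ig) Ih h≤ ¬Mh λ i →
      M-cancel-+ (subst M (coeff-∷-* a g h (suc (i + suc b))) (Mgh (suc i)))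
        (subst (λ t → M (a *ℚ t)) (sym (h≤ (suc (i + suc b)) (s≤s (ℕₚ.m≤n+m (suc b) i)))) (M-*ˡ (Ig 0) M-0))
    -- With the tail already divisible by p, the coefficient of degree `suc b` isolates `a` times
    -- the leading coefficient of `h`.
    Mah : M (a *ℚ coeff h (suc b))
    Mah = M-cancel-+ (subst M (trans (coeff-∷-* a g h (suc b)) (ℚₚ.+-comm (a *ℚ coeff h (suc b)) _)) (Mgh 0))
      (AllM-* g h Mg Ih b)

  gauss-lemma : ∀ g h → AllI g → AllI h → AllM (g *ₚ h) → AllM g ⊎ AllM h
  gauss-lemma []      h Ig Ih Mgh = inj₁ λ _ → M-0
  gauss-lemma (a ∷ g) h Ig Ih Mgh = [ divisible-head , unit-head ]′ (M-or-¬M (Ig 0))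
    where
    unit-head : ¬ M a → AllM (a ∷ g) ⊎ AllM h
    unit-head ¬Ma = inj₂ λ i → low-coefficients h (a ∷ g) Ih Ig ¬Ma (suc i)
      (λ j _ → subst M (*ₚ-comm (a ∷ g) h j) (Mgh j)) i ℕₚ.≤-refl
    divisible-head : M a → AllM (a ∷ g) ⊎ AllM h
    divisible-head Ma = map₁ (λ Mg → λ { zero → Ma ; (suc i) → Mg i })
      (gauss-lemma g h (AllI-tail {a} Ig) Ih λ i →
        M-cancel-+ (subst M (coeff-∷-* a g h (suc i)) (Mgh (suc i))) (M-*ʳ Ma (Ih (suc i))))

  -- If both degree bounds are positive, exactly one constant term is divisible by p. That factor
  -- has degree below a + b, so `low-coefficients` makes it divisible by p altogether, contradicting
  -- the unit in degree a + b. The pair `u`, `¬ M u` encodes that p² does not divide the constant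
  -- term.
  eisenstein : ∀ g h {a b u} → AllI g → AllI h → DegLe g a → DegLe h b → 0 < a + b →
    (∀ i → i < a + b → M (coeff (g *ₚ h) i)) → ¬ M (coeff (g *ₚ h) (a + b)) →
    coeff (g *ₚ h) 0 ≡ pℚ *ℚ u → ¬ M u → a ≡ 0 ⊎ b ≡ 0
  eisenstein g h {zero}  {b}     Ig Ih g≤ h≤ 0<a+b Mgh ¬Mtop eq ¬Mu = inj₁ refl
  eisenstein g h {suc a} {zero}  Ig Ih g≤ h≤ 0<a+b Mgh ¬Mtop eq ¬Mu = inj₂ refl
  eisenstein g h {suc a} {suc b} {u} Ig Ih g≤ h≤ 0<a+b Mgh ¬Mtop eq ¬Mu =
    ⊥-elim (¬Mtop ([ g-divisible , h-divisible ]′ (M-prime (Ig 0) (Ih 0) (subst M (coeff-*-0 g h) (Mgh 0 0<a+b)))))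
    where
    m : ℕ
    m = suc a + suc b
    not-both : M (coeff g 0) → ¬ M (coeff h 0)
    not-both Mg₀ Mh₀ = ¬Mu (M-*-exact Mg₀ Mh₀ (trans (sym (coeff-*-0 g h)) eq))
    extend : ∀ k {d} → DegLe k d → d < m → (∀ i → i < m → M (coeff k i)) → AllM k
    extend k k≤d d<m Mk i with ℕₚ.<-≤-connex i m
    ... | inj₁ i<m = Mk i i<m
    ... | inj₂ m≤i = subst M (sym (k≤d i (ℕₚ.<-≤-trans d<m m≤i))) M-0
    g-divisible : M (coeff g 0) → M (coeff (g *ₚ h) m)
    g-divisible Mg₀ = AllM-* g h
      (extend g g≤ (ℕₚ.m<m+n (suc a) (s≤s z≤n)) (low-coefficients g h Ig Ih (not-both Mg₀) m Mgh)) Ih m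
    h-divisible : M (coeff h 0) → M (coeff (g *ₚ h) m)
    h-divisible Mh₀ = subst M (*ₚ-comm h g m) (AllM-* h g
      (extend h h≤ (ℕₚ.m<n+m (suc b) (s≤s z≤n)) (low-coefficients h g Ih Ig (λ Mg₀ → not-both Mg₀ Mh₀) m
        (λ j j<m → subst M (*ₚ-comm g h j) (Mgh j j<m)))) Ig m)

  -- The argument is run at the leading coefficients instead of reversing the lists. They cannot
  -- both be divisible by p; if one is a unit, the product lies in `M` from that factor's positive
  -- degree upwards, so `high-coefficients` kills the other factor modulo p and with it the constant
  -- term of the product.
  eisenstein-reversed : ∀ g h {a b u} → AllI g → AllI h → DegLe g a → DegLe h b →
    (∀ i → M (coeff (g *ₚ h) (suc i))) → ¬ M (coeff (g *ₚ h) 0) →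
    coeff (g *ₚ h) (a + b) ≡ pℚ *ℚ u → ¬ M u → a ≡ 0 ⊎ b ≡ 0
  eisenstein-reversed g h {zero}  {b}     Ig Ih g≤ h≤ Mgh ¬M₀ eq ¬Mu = inj₁ refl
  eisenstein-reversed g h {suc a} {zero}  Ig Ih g≤ h≤ Mgh ¬M₀ eq ¬Mu = inj₂ refl
  eisenstein-reversed g h {suc a} {suc b} {u} Ig Ih g≤ h≤ Mgh ¬M₀ eq ¬Mu =
    ⊥-elim ([ (λ Mg → [ (λ Mh → ¬Mu (M-*-exact Mg Mh (trans (sym (coeff-*-top g g≤ h≤)) eq))) , h-unit ]′ (M-or-¬M (Ih (suc b)))) , g-unit ]′
      (M-or-¬M (Ig (suc a))))
    where
    h-unit : ¬ ¬ M (coeff h (suc b))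
    h-unit ¬Mh = ¬M₀ (AllM-* g h (high-coefficients g h b Ig Ih h≤ ¬Mh λ i →
      subst (λ j → M (coeff (g *ₚ h) j)) (sym (ℕₚ.+-suc i b)) (Mgh (i + b))) Ih 0)
    g-unit : ¬ ¬ M (coeff g (suc a))
    g-unit ¬Mg = ¬M₀ (subst M (*ₚ-comm h g 0) (AllM-* h g (high-coefficients h g a Ih Ig g≤ ¬Mg λ i →
      subst (λ j → M (coeff (h *ₚ g) j)) (sym (ℕₚ.+-suc i a)) (subst M (*ₚ-comm g h (suc (i + a))) (Mgh (i + a)))) Ig 0))

  *≢0 : ∀ {a b} → ¬ (a ≡ 0) → ¬ (b ≡ 0) → ¬ (a * b ≡ 0)
  *≢0 {a} a≢0 b≢0 ab≡0 = [ a≢0 , b≢0 ]′ (ℕₚ.m*n≡0⇒m≡0∨n≡0 a ab≡0)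

  -- `D` is the product of all denominators. It may be divisible by p, and the descent below repairs
  -- this.
  clear-denominators : ∀ f → ∃ λ D → ¬ (D ≡ 0) × AllI (scale (ℕtoℚ D) f)
  clear-denominators [] = 1 , (λ ()) , λ _ → I-ι (+ 0)
  clear-denominators (a ∷ f) =
    E * D , *≢0 {E} (λ ()) (proj₁ (proj₂ IH)) , λ where
      zero    → subst I head-eq (I-* (I-ι (+ D)) (I-ι (ℚ.↥ a)))
      (suc i) → subst I (tail-eq i) (I-* (I-ι (+ E)) (proj₂ (proj₂ IH) i))
    where
    open ≡-Reasoning
    IH : ∃ λ D → ¬ (D ≡ 0) × AllI (scale (ℕtoℚ D) f)
    IH = clear-denominators f
    D E : ℕ
    D = proj₁ IH
    E = ℚ.↧ₙ a
    head-eq : ℕtoℚ D *ℚ ι (ℚ.↥ a) ≡ ℕtoℚ (E * D) *ℚ a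
    head-eq = begin
      ℕtoℚ D *ℚ ι (ℚ.↥ a)               ≡⟨ cong (ℕtoℚ D *ℚ_) (ι-↥ a) ⟨
      ℕtoℚ D *ℚ (ℕtoℚ E *ℚ a)           ≡⟨ solve 3 (λ x y z → x :* (y :* z) := y :* x :* z) refl (ℕtoℚ D) (ℕtoℚ E) a ⟩
      ℕtoℚ E *ℚ ℕtoℚ D *ℚ a             ≡⟨ cong (_*ℚ a) (ℕtoℚ-* E D) ⟨
      ℕtoℚ (E * D) *ℚ a                 ∎
    tail-eq : ∀ i → ℕtoℚ E *ℚ coeff (scale (ℕtoℚ D) f) i ≡ coeff (scale (ℕtoℚ (E * D)) f) i
    tail-eq i = begin
      ℕtoℚ E *ℚ coeff (scale (ℕtoℚ D) f) i    ≡⟨ cong (ℕtoℚ E *ℚ_) (coeff-scale (ℕtoℚ D) f i) ⟩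
      ℕtoℚ E *ℚ (ℕtoℚ D *ℚ coeff f i)         ≡⟨ ℚₚ.*-assoc (ℕtoℚ E) (ℕtoℚ D) (coeff f i) ⟨
      ℕtoℚ E *ℚ ℕtoℚ D *ℚ coeff f i           ≡⟨ cong (_*ℚ coeff f i) (ℕtoℚ-* E D) ⟨
      ℕtoℚ (E * D) *ℚ coeff f i               ≡⟨ coeff-scale (ℕtoℚ (E * D)) f i ⟨
      coeff (scale (ℕtoℚ (E * D)) f) i        ∎

  -- The goal `C` is left abstract so that both variants of Eisenstein's criterion share one
  -- reduction; `primitive-case` has to produce it only for multipliers prime to p.
  module _ {f : Poly} (If : AllI f) {a b : ℕ} {C : Set}
    (primitive-case : ∀ D g h → ¬ p ∣ D → AllI g → AllI h → DegLe g a → DegLe h b → scale (ℕtoℚ D) f ≈ₚ g *ₚ h → C) where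

    Claim : ℕ → Set
    Claim D = ¬ (D ≡ 0) → ∀ g h → AllI g → AllI h → DegLe g a → DegLe h b → scale (ℕtoℚ D) f ≈ₚ g *ₚ h → C

    divide : Poly → Poly
    divide = scale (inverse pℚ≢0)

    AllI-divide : ∀ g → AllM g → AllI (divide g)
    AllI-divide g Mg i with Mg i
    ... | y , Iy , eq = subst I (sym (trans (coeff-scale _ g i) (trans (cong (inverse pℚ≢0 *ℚ_) eq) (inverse-cancelˡ pℚ≢0 y)))) Iy

    divide-eq : ∀ q {k} → scale (ℕtoℚ (q * p)) f ≈ₚ k → ∀ i → coeff (scale (ℕtoℚ q) f) i ≡ inverse pℚ≢0 *ℚ coeff k i
    divide-eq q {k} eq i = begin
      coeff (scale (ℕtoℚ q) f) i                               ≡⟨ coeff-scale (ℕtoℚ q) f i ⟩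
      ℕtoℚ q *ℚ coeff f i                                      ≡⟨ inverse-cancelˡ pℚ≢0 _ ⟨
      inverse pℚ≢0 *ℚ (pℚ *ℚ (ℕtoℚ q *ℚ coeff f i))            ≡⟨ cong (inverse pℚ≢0 *ℚ_) (solve 3 (λ p q x → p :* (q :* x) := q :* p :* x) refl pℚ (ℕtoℚ q) (coeff f i)) ⟩
      inverse pℚ≢0 *ℚ (ℕtoℚ q *ℚ pℚ *ℚ coeff f i)              ≡⟨ cong (λ t → inverse pℚ≢0 *ℚ (t *ℚ coeff f i)) (ℕtoℚ-* q p) ⟨
      inverse pℚ≢0 *ℚ (ℕtoℚ (q * p) *ℚ coeff f i)              ≡⟨ cong (inverse pℚ≢0 *ℚ_) (trans (sym (coeff-scale (ℕtoℚ (q * p)) f i)) (eq i)) ⟩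
      inverse pℚ≢0 *ℚ coeff k i                                ∎
      where open ≡-Reasoning

    -- When D = q p, the product of the factors is divisible by p because `f` is p-integral, so one
    -- factor can be divided by p. The multiplier drops strictly to `q`, and the degree bounds `a`
    -- and `b` survive the division.
    descent-step : ∀ D → (∀ {D′} → D′ < D → Claim D′) → Claim D
    descent-step D rec D≢0 g h Ig Ih g≤ h≤ eq with p ∣? D
    ... | no p∤D = primitive-case D g h p∤D Ig Ih g≤ h≤ eq
    ... | yes (divides q refl) = [ case-g , case-h ]′ (gauss-lemma g h Ig Ih Mgh)
      where
      Mgh : AllM (g *ₚ h)
      Mgh i = subst M (trans (sym (coeff-scale _ f i)) (eq i))
        (M-*ʳ (ℕtoℚ q , I-ι (+ q) , trans (ℕtoℚ-* q p) (ℚₚ.*-comm (ℕtoℚ q) pℚ)) (If i))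
      q≢0 : ¬ (q ≡ 0)
      q≢0 refl = D≢0 refl
      q<qp : q < q * p
      q<qp = ℕₚ.m<m*n q p {{ℕ.≢-nonZero q≢0}} (ℕ.nonTrivial⇒n>1 p {{prime⇒nonTrivial p-prime}})
      case-g : AllM g → C
      case-g Mg = rec q<qp q≢0 (divide g) h (AllI-divide g Mg) Ih (DegLe-scale _ {g} g≤) h≤
        λ i → trans (divide-eq q {g *ₚ h} eq i) (sym (coeff-scale-* (inverse pℚ≢0) g h i))
      case-h : AllM h → C
      case-h Mh = rec q<qp q≢0 g (divide h) Ig (AllI-divide h Mh) g≤ (DegLe-scale _ {h} h≤)
        λ i → trans (divide-eq q {g *ₚ h} eq i) (sym (coeff-*-scale (inverse pℚ≢0) g h i))

    factors-over-ℚ : ∀ g h → DegLe g a → DegLe h b → f ≈ₚ g *ₚ h → C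
    factors-over-ℚ g h g≤ h≤ eq = cleared (clear-denominators g) (clear-denominators h)
      where
      open ≡-Reasoning
      cleared : (∃ λ D → ¬ (D ≡ 0) × AllI (scale (ℕtoℚ D) g)) → (∃ λ E → ¬ (E ≡ 0) × AllI (scale (ℕtoℚ E) h)) → C
      cleared (D , D≢0 , Ig) (E , E≢0 , Ih) =
        <-rec Claim descent-step (D * E) (*≢0 D≢0 E≢0) (scale (ℕtoℚ D) g) (scale (ℕtoℚ E) h) Ig Ih
          (DegLe-scale (ℕtoℚ D) {g} g≤) (DegLe-scale (ℕtoℚ E) {h} h≤) λ i → begin
        coeff (scale (ℕtoℚ (D * E)) f) i                         ≡⟨ coeff-scale (ℕtoℚ (D * E)) f i ⟩
        ℕtoℚ (D * E) *ℚ coeff f i                                ≡⟨ cong₂ _*ℚ_ (ℕtoℚ-* D E) (eq i) ⟩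
        ℕtoℚ D *ℚ ℕtoℚ E *ℚ coeff (g *ₚ h) i                     ≡⟨ ℚₚ.*-assoc (ℕtoℚ D) (ℕtoℚ E) (coeff (g *ₚ h) i) ⟩
        ℕtoℚ D *ℚ (ℕtoℚ E *ℚ coeff (g *ₚ h) i)                   ≡⟨ cong (ℕtoℚ D *ℚ_) (coeff-*-scale (ℕtoℚ E) g h i) ⟨
        ℕtoℚ D *ℚ coeff (g *ₚ scale (ℕtoℚ E) h) i                ≡⟨ coeff-scale-* (ℕtoℚ D) g (scale (ℕtoℚ E) h) i ⟨
        coeff (scale (ℕtoℚ D) g *ₚ scale (ℕtoℚ E) h) i           ∎

-- The coefficients of (1 + x) ^ (- K) satisfy this recurrence in all degrees.
Recurrence : ℕ → ℕ → Poly → Set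
Recurrence K m f = ∀ i → i < m → ℕtoℚ (suc i) *ℚ coeff f (suc i) ≡ -ℚ (ℕtoℚ (K + i) *ℚ coeff f i)

-- Eisenstein's criterion applied to solutions of the recurrence

module _ {p : ℕ} (p-prime : Prime p) where
  open Localisation p-prime

  U-1 : U 1ℚ
  U-1 = U-ι {+ 1} p∤1

  -- One step of the recurrence between p-adic units: neither the multiplier `c` nor the divisor `d`
  -- involves p.
  U-step : ∀ {c d x y} → ¬ p ∣ d → ¬ p ∣ c → U y → ℕtoℚ d *ℚ x ≡ -ℚ (ℕtoℚ c *ℚ y) → U x
  U-step {c} {d} {x} {y} p∤d p∤c Uy eq = U-cancel {x} {d} p∤d (subst U (sym eq) (U-neg (U-* (U-ι {+ c} p∤c) Uy)))

  module _ {f : Poly} {m : ℕ} (f₀≡1 : coeff f 0 ≡ 1ℚ) (f≤m : DegLe f m) (0<m : 0 < m) where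

    module PrimeK (m<p : m < p) (rec : Recurrence p m f) where

      -- The multiplier at index 0 is p itself and contributes the single factor p. The later
      -- multipliers p + i with 0 < i < p, and all divisors i + 1 ≤ m < p, are units, so the
      -- quotients by p propagate through `U-step`.
      exactly-divisible : ∀ i → i < m → ∃ λ u → U u × coeff f (suc i) ≡ pℚ *ℚ u
      exactly-divisible zero 0<m = -ℚ 1ℚ , U-neg U-1 , (begin
        coeff f 1                        ≡⟨ ℚₚ.*-identityˡ (coeff f 1) ⟨
        1ℚ *ℚ coeff f 1                  ≡⟨ rec 0 0<m ⟩
        -ℚ (ℕtoℚ (p + 0) *ℚ coeff f 0)   ≡⟨ cong₂ (λ x y → -ℚ (ℕtoℚ x *ℚ y)) (ℕₚ.+-identityʳ p) f₀≡1 ⟩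
        -ℚ (pℚ *ℚ 1ℚ)                    ≡⟨ solve 1 (λ x → :- (x :* con 1ℚ) := x :* con (-ℚ 1ℚ)) refl pℚ ⟩
        pℚ *ℚ -ℚ 1ℚ                      ∎)
        where open ≡-Reasoning
      exactly-divisible (suc i) i+1<m = next (exactly-divisible i (ℕₚ.<-trans (ℕₚ.n<1+n i) i+1<m))
        where
        open ≡-Reasoning
        r : ℚ
        r = inverse pℚ≢0
        next : (∃ λ u → U u × coeff f (suc i) ≡ pℚ *ℚ u) → ∃ λ u → U u × coeff f (suc (suc i)) ≡ pℚ *ℚ u
        next (u , Uu , eq) = r *ℚ coeff f (suc (suc i)) ,
          U-step {p + suc i} {suc (suc i)} {r *ℚ coeff f (suc (suc i))} {u}
            (>⇒∤ (ℕₚ.≤-<-trans i+1<m m<p))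
            (λ p∣p+i → >⇒∤ (ℕₚ.<-trans i+1<m m<p) (∣m+n∣m⇒∣n p∣p+i ∣-refl)) Uu (begin
              ℕtoℚ (suc (suc i)) *ℚ (r *ℚ coeff f (suc (suc i)))
                ≡⟨ solve 3 (λ d r x → d :* (r :* x) := r :* (d :* x)) refl (ℕtoℚ (suc (suc i))) r (coeff f (suc (suc i))) ⟩
              r *ℚ (ℕtoℚ (suc (suc i)) *ℚ coeff f (suc (suc i)))
                ≡⟨ cong (r *ℚ_) (trans (rec (suc i) i+1<m) (cong (λ t → -ℚ (ℕtoℚ (p + suc i) *ℚ t)) eq)) ⟩
              r *ℚ -ℚ (ℕtoℚ (p + suc i) *ℚ (pℚ *ℚ u))
                ≡⟨ solve 4 (λ r c p u → r :* :- (c :* (p :* u)) := r :* (p :* :- (c :* u))) refl r (ℕtoℚ (p + suc i)) pℚ u ⟩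
              r *ℚ (pℚ *ℚ -ℚ (ℕtoℚ (p + suc i) *ℚ u))
                ≡⟨ inverse-cancelˡ pℚ≢0 _ ⟩
              -ℚ (ℕtoℚ (p + suc i) *ℚ u) ∎) ,
          sym (inverse-cancelʳ pℚ≢0 _)

      M-positive : ∀ i → M (coeff f (suc i))
      M-positive i with ℕₚ.<-≤-connex i m
      ... | inj₂ m≤i = subst M (sym (f≤m (suc i) (s≤s m≤i))) M-0
      ... | inj₁ i<m = let (u , Uu , eq) = exactly-divisible i i<m in u , proj₁ Uu , eq

      no-factors : ∀ g h {a b} → DegLe g a → DegLe h b → a + b ≡ m → f ≈ₚ g *ₚ h → a ≡ 0 ⊎ b ≡ 0
      no-factors g h {a} {b} g≤ h≤ a+b≡m = factors-over-ℚ {f} If {a} {b} primitive-case g h g≤ h≤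
        where
        If : AllI f
        If zero    = subst I (sym f₀≡1) (proj₁ U-1)
        If (suc i) = M⇒I (M-positive i)

        primitive-case : ∀ D g h → ¬ p ∣ D → AllI g → AllI h → DegLe g a → DegLe h b → scale (ℕtoℚ D) f ≈ₚ g *ₚ h → a ≡ 0 ⊎ b ≡ 0
        -- `exactly-divisible` at index i concerns coefficient i + 1, so the leading coefficient,
        -- where exactness is required, is reached at `ℕ.pred m`.
        primitive-case D g h p∤D Ig Ih g≤ h≤ eq = top (exactly-divisible (ℕ.pred m) (subst (ℕ.pred m <_) suc-pred-m ℕₚ.≤-refl))
          where
          suc-pred-m : suc (ℕ.pred m) ≡ m
          suc-pred-m = ℕₚ.suc-pred m {{ℕ.>-nonZero 0<m}}
          UD : U (ℕtoℚ D)
          UD = U-ι {+ D} p∤D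
          gh : ∀ i → ℕtoℚ D *ℚ coeff f i ≡ coeff (g *ₚ h) i
          gh i = trans (sym (coeff-scale (ℕtoℚ D) f i)) (eq i)
          top : (∃ λ u → U u × coeff f (suc (ℕ.pred m)) ≡ pℚ *ℚ u) → a ≡ 0 ⊎ b ≡ 0
          top (u , Uu , fm≡pu) = eisenstein-reversed g h {u = ℕtoℚ D *ℚ u} Ig Ih g≤ h≤
            (λ i → subst M (gh (suc i)) (M-*ˡ (proj₁ UD) (M-positive i)))
            (λ M₀ → proj₂ (U-* UD U-1) (subst (λ t → M (ℕtoℚ D *ℚ t)) f₀≡1 (subst M (sym (gh 0)) M₀)))
            (trans (sym (gh (a + b))) (trans (cong (λ j → ℕtoℚ D *ℚ coeff f j) (trans a+b≡m (sym suc-pred-m)))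
              (trans (cong (ℕtoℚ D *ℚ_) fm≡pu) (solve 3 (λ d p u → d :* (p :* u) := p :* (d :* u)) refl (ℕtoℚ D) pℚ u))))
            (proj₂ (U-* UD Uu))

    module PrimeK+m {K : ℕ} (K+m≡p : suc K + m ≡ p) (rec : Recurrence (suc K) m f) where

      c : ℚ
      c = coeff f m

      p∤K+ : ∀ i → i < m → ¬ p ∣ suc K + i
      p∤K+ i i<m = >⇒∤ (subst (suc K + i <_) K+m≡p (ℕₚ.+-monoʳ-< (suc K) i<m))

      m<p : m < p
      m<p = subst (m <_) K+m≡p (s≤s (ℕₚ.m≤n+m m K))

      -- The multipliers K + i with i < m stay strictly between 0 and p, reaching p only at i = m,
      -- beyond the range of the recurrence.
      unit-coefficients : ∀ i → i ≤ m → U (coeff f i)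
      unit-coefficients zero    _   = subst U (sym f₀≡1) U-1
      unit-coefficients (suc i) i<m = U-step {suc K + i} {suc i} {coeff f (suc i)} {coeff f i}
        (>⇒∤ (ℕₚ.≤-<-trans i<m m<p)) (p∤K+ i i<m) (unit-coefficients i (ℕₚ.<⇒≤ i<m)) (rec i i<m)

      If : AllI f
      If i with ℕₚ.<-≤-connex m i
      ... | inj₁ m<i = subst I (sym (f≤m i m<i)) (I-ι (+ 0))
      ... | inj₂ i≤m = proj₁ (unit-coefficients i i≤m)

      -- Below degree m the recurrence is the vanishing of the left side. In degree m the truncation
      -- leaves (K + m) f_m = p f_m, and above it nothing remains.
      ode : deriv f +ₚ derivAux (suc K) f ≈ₚ scale pℚ (monomial m c)
      ode i = begin
        coeff (deriv f +ₚ derivAux (suc K) f) i                                        ≡⟨ coeff-+ (deriv f) (derivAux (suc K) f) i ⟩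
        coeff (deriv f) i +ℚ coeff (derivAux (suc K) f) i                              ≡⟨ cong₂ _+ℚ_ (coeff-deriv f i) (coeff-derivAux (suc K) f i) ⟩
        ℕtoℚ (suc i) *ℚ coeff f (suc i) +ℚ ℕtoℚ (suc K + i) *ℚ coeff f i               ≡⟨ by-degree (ℕₚ.<-cmp i m) ⟩
        pℚ *ℚ coeff (monomial m c) i                                                   ≡⟨ coeff-scale pℚ (monomial m c) i ⟨
        coeff (scale pℚ (monomial m c)) i                                              ∎
        where
        open ≡-Reasoning
        by-degree : Tri (i < m) (i ≡ m) (m < i) →
          ℕtoℚ (suc i) *ℚ coeff f (suc i) +ℚ ℕtoℚ (suc K + i) *ℚ coeff f i ≡ pℚ *ℚ coeff (monomial m c) i
        by-degree (tri< i<m _ _) = trans (cong (_+ℚ ℕtoℚ (suc K + i) *ℚ coeff f i) (rec i i<m))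
          (trans (ℚₚ.+-inverseˡ (ℕtoℚ (suc K + i) *ℚ coeff f i))
            (sym (trans (cong (pℚ *ℚ_) (coeff-monomial-< m c i i<m)) (ℚₚ.*-zeroʳ pℚ))))
        by-degree (tri≈ _ refl _) = trans (cong (λ t → ℕtoℚ (suc i) *ℚ t +ℚ ℕtoℚ (suc K + i) *ℚ coeff f i) (f≤m (suc i) ℕₚ.≤-refl))
          (trans (cong (_+ℚ ℕtoℚ (suc K + i) *ℚ coeff f i) (ℚₚ.*-zeroʳ (ℕtoℚ (suc i))))
            (trans (ℚₚ.+-identityˡ _) (cong₂ (λ j t → ℕtoℚ j *ℚ t) K+m≡p (sym (coeff-monomial m c)))))
        by-degree (tri> _ _ m<i) =
          trans (cong₂ (λ s t → ℕtoℚ (suc i) *ℚ s +ℚ ℕtoℚ (suc K + i) *ℚ t) (f≤m (suc i) (ℕₚ.m<n⇒m<1+n m<i)) (f≤m i m<i))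
            (trans (solve 3 (λ x y z → x :* con 0ℚ :+ y :* con 0ℚ := z :* con 0ℚ) refl (ℕtoℚ (suc i)) (ℕtoℚ (suc K + i)) pℚ)
              (cong (pℚ *ℚ_) (sym (DegLe-monomial m c i m<i))))

      t : Poly
      t = shift (monomial m c)

      AllI-monomial : ∀ n → AllI (monomial n c)
      AllI-monomial zero    zero    = If m
      AllI-monomial zero    (suc i) = I-ι (+ 0)
      AllI-monomial (suc n) zero    = I-ι (+ 0)
      AllI-monomial (suc n) (suc i) = AllI-monomial n i

      U-shift-monomial-0 : ∀ n → U (coeff (shift (monomial n c)) 0)
      U-shift-monomial-0 zero    = subst U (sym (coeff-shift-monomial-top 0 c)) (unit-coefficients m ℕₚ.≤-refl)
      U-shift-monomial-0 (suc n) = subst U (sym (coeff-shift-monomial-0 n c)) (U-neg (U-shift-monomial-0 n))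

      shifted-coefficients : ∀ i → ℕtoℚ (suc K + i) *ℚ coeff (shift f) i ≡ pℚ *ℚ coeff t i
      shifted-coefficients i = begin
        ℕtoℚ (suc K + i) *ℚ coeff (shift f) i                ≡⟨ coeff-derivAux (suc K) (shift f) i ⟨
        coeff (derivAux (suc K) (shift f)) i                 ≡⟨ shift-deriv (suc K) f i ⟨
        coeff (shift (deriv f +ₚ derivAux (suc K) f)) i      ≡⟨ shift-cong (deriv f +ₚ derivAux (suc K) f) (scale pℚ (monomial m c)) ode i ⟩
        coeff (shift (scale pℚ (monomial m c))) i            ≡⟨ coeff-shift-scale pℚ (monomial m c) i ⟩
        pℚ *ℚ coeff t i                                      ∎
        where open ≡-Reasoning

      M-low : ∀ i → i < m → M (coeff (shift f) i)
      M-low i i<m = M-cancel (U-ι {+ (suc K + i)} (p∤K+ i i<m)) (AllI-shift f If i)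
        (coeff t i , AllI-shift (monomial m c) (AllI-monomial m) i , shifted-coefficients i)

      u : ℚ
      u = inverse pℚ≢0 *ℚ coeff (shift f) 0

      -- K u is the constant term of c (y - 1)^m, that is, c up to sign, and K is prime to p. Hence
      -- the constant term in y is divisible by p exactly once.
      U-u : U u
      U-u = U-cancel {u} {suc K} (subst (λ j → ¬ p ∣ j) (ℕₚ.+-identityʳ (suc K)) (p∤K+ 0 0<m)) (subst U (sym (begin
        ℕtoℚ (suc K) *ℚ (inverse pℚ≢0 *ℚ coeff (shift f) 0)          ≡⟨ solve 3 (λ k r x → k :* (r :* x) := r :* (k :* x)) refl (ℕtoℚ (suc K)) (inverse pℚ≢0) (coeff (shift f) 0) ⟩
        inverse pℚ≢0 *ℚ (ℕtoℚ (suc K) *ℚ coeff (shift f) 0)          ≡⟨ cong (λ j → inverse pℚ≢0 *ℚ (ℕtoℚ j *ℚ coeff (shift f) 0)) (ℕₚ.+-identityʳ (suc K)) ⟨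
        inverse pℚ≢0 *ℚ (ℕtoℚ (suc K + 0) *ℚ coeff (shift f) 0)      ≡⟨ cong (inverse pℚ≢0 *ℚ_) (shifted-coefficients 0) ⟩
        inverse pℚ≢0 *ℚ (pℚ *ℚ coeff t 0)                            ≡⟨ inverse-cancelˡ pℚ≢0 (coeff t 0) ⟩
        coeff t 0                                                    ∎)) (U-shift-monomial-0 m))
        where open ≡-Reasoning

      -- In degree m the diagonal entry K + m is p itself and cancels the p on the right, so the
      -- leading coefficient stays the unit `c`.
      U-top : U (coeff (shift f) m)
      U-top = subst U (sym (trans (*ℚ-cancelˡ pℚ≢0 (trans (cong (λ j → ℕtoℚ j *ℚ coeff (shift f) m) (sym K+m≡p)) (shifted-coefficients m)))
        (coeff-shift-monomial-top m c))) (unit-coefficients m ℕₚ.≤-refl)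

      no-factors : ∀ g h {a b} → DegLe g a → DegLe h b → a + b ≡ m → f ≈ₚ g *ₚ h → a ≡ 0 ⊎ b ≡ 0
      no-factors g h {a} {b} g≤ h≤ refl = factors-over-ℚ {f} If {a} {b} primitive-case g h g≤ h≤
        where
        primitive-case : ∀ D g h → ¬ p ∣ D → AllI g → AllI h → DegLe g a → DegLe h b → scale (ℕtoℚ D) f ≈ₚ g *ₚ h → a ≡ 0 ⊎ b ≡ 0
        primitive-case D g h p∤D Ig Ih g≤ h≤ eq =
          eisenstein (shift g) (shift h) {u = ℕtoℚ D *ℚ u} (AllI-shift g Ig) (AllI-shift h Ih) (DegLe-shift g g≤) (DegLe-shift h h≤) 0<m
            (λ i i<m → subst M (gh i) (M-*ˡ (proj₁ UD) (M-low i i<m)))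
            (λ Mtop → proj₂ (U-* UD U-top) (subst M (sym (gh m)) Mtop))
            (trans (sym (gh 0)) (trans (cong (ℕtoℚ D *ℚ_) (sym (inverse-cancelʳ pℚ≢0 (coeff (shift f) 0))))
              (solve 3 (λ d p u → d :* (p :* u) := p :* (d :* u)) refl (ℕtoℚ D) pℚ u)))
            (proj₂ (U-* UD U-u))
          where
          UD : U (ℕtoℚ D)
          UD = U-ι {+ D} p∤D
          gh : ∀ i → ℕtoℚ D *ℚ coeff (shift f) i ≡ coeff (shift g *ₚ shift h) i
          gh i = trans (sym (coeff-shift-scale (ℕtoℚ D) f i))
            (trans (shift-cong (scale (ℕtoℚ D) f) (g *ₚ h) eq i) (shift-* g h i))

-- The coefficients of Q

coeff-one-* : ∀ f i → coeff (oneₚ *ₚ f) i ≡ coeff f i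
coeff-one-* f i = trans (coeff-∷-* 1ℚ [] f i)
  (trans (cong (1ℚ *ℚ coeff f i +ℚ_) (0∷-[] {[]} (λ _ → refl) i)) (trans (ℚₚ.+-identityʳ _) (ℚₚ.*-identityˡ _)))

X-* : ∀ f → X *ₚ f ≈ₚ 0ℚ ∷ f
X-* f i = trans (coeff-∷-* 0ℚ oneₚ f i)
  (trans (cong₂ _+ℚ_ (ℚₚ.*-zeroˡ (coeff f i)) (∷-cong refl (coeff-one-* f) i)) (ℚₚ.+-identityˡ _))

X+1-* : ∀ f → X+1 *ₚ f ≈ₚ f +ₚ (0ℚ ∷ f)
X+1-* f i = trans (coeff-∷-* 1ℚ oneₚ f i)
  (trans (cong₂ _+ℚ_ (ℚₚ.*-identityˡ (coeff f i)) (∷-cong refl (coeff-one-* f) i)) (sym (coeff-+ f (0ℚ ∷ f) i)))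

*ₚ-0∷ : ∀ f g → f *ₚ (0ℚ ∷ g) ≈ₚ 0ℚ ∷ f *ₚ g
*ₚ-0∷ f g i = trans (*ₚ-∷ f 0ℚ g i) (trans (cong (_+ℚ coeff (0ℚ ∷ f *ₚ g) i) (ℚₚ.*-zeroˡ (coeff f i))) (ℚₚ.+-identityˡ _))

*X^-low : ∀ f r i → i < r → coeff (f *ₚ X ^ₚ r) i ≡ 0ℚ
*X^-low f (suc r) i i<r = trans (*ₚ-congˡ f (X-* (X ^ₚ r)) i) (trans (*ₚ-0∷ f (X ^ₚ r) i) (low i i<r))
  where
  low : ∀ i → i < suc r → coeff (0ℚ ∷ f *ₚ X ^ₚ r) i ≡ 0ℚ
  low zero    _         = refl
  low (suc i) (s≤s i<r) = *X^-low f r i i<r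

*X+1^-suc : ∀ f r i → coeff (f *ₚ X+1 ^ₚ suc r) i ≡ coeff (f *ₚ X+1 ^ₚ r) i +ℚ coeff (0ℚ ∷ f *ₚ X+1 ^ₚ r) i
*X+1^-suc f r i = begin
  coeff (f *ₚ (X+1 *ₚ w)) i                             ≡⟨ *ₚ-congˡ f (X+1-* w) i ⟩
  coeff (f *ₚ (w +ₚ (0ℚ ∷ w))) i                        ≡⟨ *ₚ-comm f _ i ⟩
  coeff ((w +ₚ (0ℚ ∷ w)) *ₚ f) i                        ≡⟨ coeff-+-* w (0ℚ ∷ w) f i ⟩
  coeff (w *ₚ f) i +ℚ coeff ((0ℚ ∷ w) *ₚ f) i           ≡⟨ cong₂ _+ℚ_ (*ₚ-comm w f i) (*ₚ-comm (0ℚ ∷ w) f i) ⟩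
  coeff (f *ₚ w) i +ℚ coeff (f *ₚ (0ℚ ∷ w)) i           ≡⟨ cong (coeff (f *ₚ w) i +ℚ_) (*ₚ-0∷ f w i) ⟩
  coeff (f *ₚ w) i +ℚ coeff (0ℚ ∷ f *ₚ w) i             ∎
  where
  open ≡-Reasoning
  w : Poly
  w = X+1 ^ₚ r

-- For f = (1 + x) g, the expression (1 + x) f' + K f equals (1 + x) ((1 + x) g' + (K + 1) g). If it
-- vanishes below degree m, so does the inner factor, because 1 + x has constant term 1.
Recurrence-/X+1 : ∀ {K m} f g → (∀ i → coeff f i ≡ coeff g i +ℚ coeff (0ℚ ∷ g) i) → Recurrence K m f → Recurrence (suc K) m g
Recurrence-/X+1 {K} {m} f g f≡ rec zero 0<m = begin
  1ℚ *ℚ coeff g 1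
    ≡⟨ solve 2 (λ x y → con 1ℚ :* x := con 1ℚ :* (x :+ y) :+ :- y) refl (coeff g 1) (coeff g 0) ⟩
  1ℚ *ℚ (coeff g 1 +ℚ coeff g 0) +ℚ -ℚ coeff g 0
    ≡⟨ cong (λ t → 1ℚ *ℚ t +ℚ -ℚ coeff g 0) (f≡ 1) ⟨
  1ℚ *ℚ coeff f 1 +ℚ -ℚ coeff g 0
    ≡⟨ cong (_+ℚ -ℚ coeff g 0) (trans (rec 0 0<m) (cong (λ t → -ℚ (ℕtoℚ (K + 0) *ℚ t)) (f≡ 0))) ⟩
  -ℚ (ℕtoℚ (K + 0) *ℚ (coeff g 0 +ℚ 0ℚ)) +ℚ -ℚ coeff g 0
    ≡⟨ solve 2 (λ k x → :- (k :* (x :+ con 0ℚ)) :+ :- x := :- ((con 1ℚ :+ k) :* x)) refl (ℕtoℚ (K + 0)) (coeff g 0) ⟩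
  -ℚ ((1ℚ +ℚ ℕtoℚ (K + 0)) *ℚ coeff g 0)
    ≡⟨ cong (λ t → -ℚ (t *ℚ coeff g 0)) (ℕtoℚ-suc (K + 0)) ⟨
  -ℚ (ℕtoℚ (suc K + 0) *ℚ coeff g 0) ∎
  where open ≡-Reasoning
Recurrence-/X+1 {K} {m} f g f≡ rec (suc i) i+1<m = begin
  ℕtoℚ (suc (suc i)) *ℚ g₂
    ≡⟨ cong (_*ℚ g₂) (ℕtoℚ-suc (suc i)) ⟩
  (1ℚ +ℚ s) *ℚ g₂
    ≡⟨ solve 3 (λ s x y → (con 1ℚ :+ s) :* x := (con 1ℚ :+ s) :* (x :+ y) :+ :- y :+ :- (s :* y)) refl s g₂ g₁ ⟩
  (1ℚ +ℚ s) *ℚ (g₂ +ℚ g₁) +ℚ -ℚ g₁ +ℚ -ℚ (s *ℚ g₁)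
    -- Cancelling 1 + x from the bottom: the recurrence for `f` fixes the sum of two neighbouring
    -- coefficients of the inner factor, and the induction hypothesis removes the lower one.
    ≡⟨ cong₂ (λ x y → x +ℚ -ℚ g₁ +ℚ -ℚ y) from-f (Recurrence-/X+1 {K} {m} f g f≡ rec i (ℕₚ.<-trans (ℕₚ.n<1+n i) i+1<m)) ⟩
  -ℚ (ℕtoℚ (K + suc i) *ℚ (g₁ +ℚ g₀)) +ℚ -ℚ g₁ +ℚ -ℚ (-ℚ (ℕtoℚ (suc K + i) *ℚ g₀))
    ≡⟨ cong (λ j → -ℚ (ℕtoℚ (K + suc i) *ℚ (g₁ +ℚ g₀)) +ℚ -ℚ g₁ +ℚ -ℚ (-ℚ (ℕtoℚ j *ℚ g₀))) (ℕₚ.+-suc K i) ⟨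
  -ℚ (k *ℚ (g₁ +ℚ g₀)) +ℚ -ℚ g₁ +ℚ -ℚ (-ℚ (k *ℚ g₀))
    ≡⟨ solve 3 (λ k x y → :- (k :* (x :+ y)) :+ :- x :+ :- (:- (k :* y)) := :- ((con 1ℚ :+ k) :* x)) refl k g₁ g₀ ⟩
  -ℚ ((1ℚ +ℚ k) *ℚ g₁)
    ≡⟨ cong (λ t → -ℚ (t *ℚ g₁)) (ℕtoℚ-suc (K + suc i)) ⟨
  -ℚ (ℕtoℚ (suc K + suc i) *ℚ g₁) ∎
  where
  open ≡-Reasoning
  g₀ g₁ g₂ s k : ℚ
  g₀ = coeff g i
  g₁ = coeff g (suc i)
  g₂ = coeff g (suc (suc i))
  s = ℕtoℚ (suc i)
  k = ℕtoℚ (K + suc i)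
  from-f : (1ℚ +ℚ s) *ℚ (g₂ +ℚ g₁) ≡ -ℚ (k *ℚ (g₁ +ℚ g₀))
  from-f = begin
    (1ℚ +ℚ s) *ℚ (g₂ +ℚ g₁)                         ≡⟨ cong₂ _*ℚ_ (ℕtoℚ-suc (suc i)) (f≡ (suc (suc i))) ⟨
    ℕtoℚ (suc (suc i)) *ℚ coeff f (suc (suc i))     ≡⟨ rec (suc i) i+1<m ⟩
    -ℚ (k *ℚ coeff f (suc i))                       ≡⟨ cong (λ t → -ℚ (k *ℚ t)) (f≡ (suc i)) ⟩
    -ℚ (k *ℚ (g₁ +ℚ g₀))                            ∎

module _ {n : ℕ} {P Q : Poly} (pq : IsPQPair n P Q) where

  *X+1^-coefficients : ∀ i → i < suc n → coeff (Q *ₚ X+1 ^ₚ suc n) i ≡ coeff oneₚ i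
  *X+1^-coefficients i i<n = begin
    coeff (Q *ₚ X+1 ^ₚ suc n) i                                       ≡⟨ ℚₚ.+-identityˡ _ ⟨
    0ℚ +ℚ coeff (Q *ₚ X+1 ^ₚ suc n) i                                 ≡⟨ cong (_+ℚ coeff (Q *ₚ X+1 ^ₚ suc n) i) (*X^-low P (suc n) i i<n) ⟨
    coeff (P *ₚ X ^ₚ suc n) i +ℚ coeff (Q *ₚ X+1 ^ₚ suc n) i          ≡⟨ coeff-+ (P *ₚ X ^ₚ suc n) (Q *ₚ X+1 ^ₚ suc n) i ⟨
    coeff (P *ₚ X ^ₚ suc n +ₚ Q *ₚ X+1 ^ₚ suc n) i                    ≡⟨ proj₂ (proj₂ pq) i ⟩
    coeff oneₚ i                                                      ∎
    where open ≡-Reasoning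

  -- The induction replaces the binomial series. At K = 0 the product agrees with 1 through degree
  -- n, and both sides of the recurrence are 0; each removed factor x + 1 raises `K` by one, until r
  -- = 0 leaves `Q` with K = n + 1.
  *X+1^-recurrence : ∀ K r → K + r ≡ suc n → Recurrence K n (Q *ₚ X+1 ^ₚ r) × coeff (Q *ₚ X+1 ^ₚ r) 0 ≡ 1ℚ
  *X+1^-recurrence zero r refl = base , *X+1^-coefficients 0 (s≤s z≤n)
    where
    vanish : ∀ i → ℕtoℚ i *ℚ coeff oneₚ i ≡ 0ℚ
    vanish zero    = refl
    vanish (suc i) = ℚₚ.*-zeroʳ (ℕtoℚ (suc i))
    base : Recurrence 0 n (Q *ₚ X+1 ^ₚ suc n)
    base i i<n = trans (cong (ℕtoℚ (suc i) *ℚ_) (*X+1^-coefficients (suc i) (s≤s i<n)))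
      (trans (vanish (suc i)) (sym (cong -ℚ_ (trans (cong (ℕtoℚ i *ℚ_) (*X+1^-coefficients i (ℕₚ.m<n⇒m<1+n i<n))) (vanish i)))))
  *X+1^-recurrence (suc K) r eq =
    let (rec , f₀≡1) = *X+1^-recurrence K (suc r) (trans (ℕₚ.+-suc K r) eq) in
    Recurrence-/X+1 {K} {n} (Q *ₚ X+1 ^ₚ suc r) (Q *ₚ X+1 ^ₚ r) (*X+1^-suc Q r) rec ,
    trans (sym (ℚₚ.+-identityʳ _)) (trans (sym (*X+1^-suc Q r 0)) f₀≡1)

  *-oneₚ : Q *ₚ oneₚ ≈ₚ Q
  *-oneₚ i = trans (*ₚ-comm Q oneₚ i) (coeff-one-* Q i)

  Q-recurrence : Recurrence (suc n) n Q
  Q-recurrence i i<n = trans (cong (ℕtoℚ (suc i) *ℚ_) (sym (*-oneₚ (suc i))))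
    (trans (proj₁ (*X+1^-recurrence (suc n) 0 (ℕₚ.+-identityʳ (suc n))) i i<n) (cong (λ t → -ℚ (ℕtoℚ (suc n + i) *ℚ t)) (*-oneₚ i)))

  Q₀≢0 : ¬ (coeff Q 0 ≡ 0ℚ)
  Q₀≢0 eq = ℕtoℚ-suc≢0 0
    (trans (sym (proj₂ (*X+1^-recurrence (suc n) 0 (ℕₚ.+-identityʳ (suc n))))) (trans (*-oneₚ 0) eq))

-- Passage to derivatives and the conclusion

neg-≢0 : ∀ {x} → ¬ (x ≡ 0ℚ) → ¬ (-ℚ x ≡ 0ℚ)
neg-≢0 x≢0 -x≡0 = x≢0 (ℚₚ.neg-injective -x≡0)

-- Over ℚ every multiplier `suc K + i` is nonzero. This yields the exact degree m, and also the
-- nonzero constant term of the derivative.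
Recurrence-≢0 : ∀ {K m f} → Recurrence (suc K) m f → ¬ (coeff f 0 ≡ 0ℚ) → ∀ i → i ≤ m → ¬ (coeff f i ≡ 0ℚ)
Recurrence-≢0 rec f₀≢0 zero    _   = f₀≢0
Recurrence-≢0 {K} {m} {f} rec f₀≢0 (suc i) i<m eq =
  neg-≢0 (*ℚ-≢0 (ℕtoℚ-suc≢0 (K + i)) (Recurrence-≢0 {K} {m} {f} rec f₀≢0 i (ℕₚ.<⇒≤ i<m)))
    (trans (sym (rec i i<m)) (trans (cong (ℕtoℚ (suc i) *ℚ_) eq) (ℚₚ.*-zeroʳ (ℕtoℚ (suc i)))))

Recurrence-scale : ∀ {K m} c f → Recurrence K m f → Recurrence K m (scale c f)
Recurrence-scale {K} c f rec i i<m = begin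
  ℕtoℚ (suc i) *ℚ coeff (scale c f) (suc i)        ≡⟨ cong (ℕtoℚ (suc i) *ℚ_) (coeff-scale c f (suc i)) ⟩
  ℕtoℚ (suc i) *ℚ (c *ℚ coeff f (suc i))           ≡⟨ solve 3 (λ s c x → s :* (c :* x) := c :* (s :* x)) refl (ℕtoℚ (suc i)) c (coeff f (suc i)) ⟩
  c *ℚ (ℕtoℚ (suc i) *ℚ coeff f (suc i))           ≡⟨ cong (c *ℚ_) (rec i i<m) ⟩
  c *ℚ -ℚ (ℕtoℚ (K + i) *ℚ coeff f i)              ≡⟨ solve 3 (λ c k x → c :* :- (k :* x) := :- (k :* (c :* x))) refl c (ℕtoℚ (K + i)) (coeff f i) ⟩
  -ℚ (ℕtoℚ (K + i) *ℚ (c *ℚ coeff f i))            ≡⟨ cong (λ t → -ℚ (ℕtoℚ (K + i) *ℚ t)) (coeff-scale c f i) ⟨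
  -ℚ (ℕtoℚ (K + i) *ℚ coeff (scale c f) i)         ∎
  where open ≡-Reasoning

-- Differentiating (1 + x) f' + K f gives (1 + x) f'' + (K + 1) f', and the order of vanishing at 0
-- falls by one.
Recurrence-deriv : ∀ {K m} f → Recurrence K (suc m) f → Recurrence (suc K) m (deriv f)
Recurrence-deriv {K} f rec i i<m = begin
  ℕtoℚ (suc i) *ℚ coeff (deriv f) (suc i)                        ≡⟨ cong (ℕtoℚ (suc i) *ℚ_) (trans (coeff-deriv f (suc i)) (rec (suc i) (s≤s i<m))) ⟩
  ℕtoℚ (suc i) *ℚ -ℚ (ℕtoℚ (K + suc i) *ℚ coeff f (suc i))       ≡⟨ solve 3 (λ s k x → s :* :- (k :* x) := :- (k :* (s :* x))) refl (ℕtoℚ (suc i)) (ℕtoℚ (K + suc i)) (coeff f (suc i)) ⟩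
  -ℚ (ℕtoℚ (K + suc i) *ℚ (ℕtoℚ (suc i) *ℚ coeff f (suc i)))     ≡⟨ cong₂ (λ j t → -ℚ (ℕtoℚ j *ℚ t)) (ℕₚ.+-suc K i) (sym (coeff-deriv f i)) ⟩
  -ℚ (ℕtoℚ (suc K + i) *ℚ coeff (deriv f) i)                     ∎
  where open ≡-Reasoning

DegLe-deriv : ∀ f {m} → DegLe f (suc m) → DegLe (deriv f) m
DegLe-deriv f f≤ i m<i = trans (coeff-deriv f i)
  (trans (cong (ℕtoℚ (suc i) *ℚ_) (f≤ (suc i) (s≤s m<i))) (ℚₚ.*-zeroʳ (ℕtoℚ (suc i))))

derivⁿ-properties : ∀ {n P Q} → IsPQPair n P Q → ∀ k m → k + m ≡ n →
  DegLe (derivⁿ k Q) m × Recurrence (suc (k + n)) m (derivⁿ k Q) × ¬ (coeff (derivⁿ k Q) 0 ≡ 0ℚ)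
derivⁿ-properties {n} {P} {Q} pq zero m refl = proj₁ (proj₂ pq) , Q-recurrence {n} {P} {Q} pq , Q₀≢0 {n} {P} {Q} pq
derivⁿ-properties {n} {P} {Q} pq (suc k) m eq =
  let f = derivⁿ k Q
      (f≤ , rec , f₀≢0) = derivⁿ-properties {n} {P} {Q} pq k (suc m) (trans (ℕₚ.+-suc k m) eq)
  in DegLe-deriv f f≤ , Recurrence-deriv {suc (k + n)} {m} f rec ,
     λ f′₀≡0 → Recurrence-≢0 {k + n} {suc m} {f} rec f₀≢0 1 (s≤s z≤n)
       (trans (sym (ℚₚ.*-identityˡ (coeff f 1))) (trans (sym (coeff-deriv f 0)) f′₀≡0))

-- The bound `m < suc K` guarantees m < p when p = `suc K`; when p = `suc K + m` the same inequality
-- follows from p itself.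
Recurrence⇒Irreducible : ∀ {K m} f → 0 < m → m < suc K → DegLe f m → Recurrence (suc K) m f → ¬ (coeff f 0 ≡ 0ℚ) →
  Prime (suc K) ⊎ Prime (suc K + m) → Irreducible f
Recurrence⇒Irreducible {K} {m} f 0<m m<K f≤m rec f₀≢0 primes =
  (λ f≈[] → f₀≢0 (f≈[] 0)) , not-unit , factors
  where
  f-deg : HasDeg f m
  f-deg = f≤m , Recurrence-≢0 {K} {m} {f} rec f₀≢0 m ℕₚ.≤-refl

  not-unit : ¬ IsUnit f
  not-unit (c , c≢0 , f≈c) =
    ℕₚ.<⇒≢ 0<m (sym (HasDeg-unique {f} {c ∷ []} f≈c f-deg (DegLe-monomial 0 c , c≢0)))

  r : ℚ
  r = inverse f₀≢0

  e : Poly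
  e = scale r f

  e₀≡1 : coeff e 0 ≡ 1ℚ
  e₀≡1 = trans (coeff-scale r f 0) (inverseˡ f₀≢0)

  no-factors : ∀ g h {a b} → DegLe g a → DegLe h b → a + b ≡ m → f ≈ₚ g *ₚ h → a ≡ 0 ⊎ b ≡ 0
  -- Normalising the constant term to 1 multiplies f by `r`, which is absorbed into the factor `g`.
  no-factors g h g≤ h≤ a+b≡m f≈gh = [ (λ K-prime → PrimeK.no-factors K-prime {e} {m} e₀≡1 e≤m 0<m m<K rec-e (scale r g) h rg≤ h≤ a+b≡m e≈)
    , (λ K+m-prime → PrimeK+m.no-factors K+m-prime {e} {m} e₀≡1 e≤m 0<m {K} refl rec-e (scale r g) h rg≤ h≤ a+b≡m e≈) ]′ primes
    where
    e≤m : DegLe e m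
    e≤m = DegLe-scale r {f} f≤m
    rec-e : Recurrence (suc K) m e
    rec-e = Recurrence-scale {suc K} {m} r f rec
    rg≤ : DegLe (scale r g) _
    rg≤ = DegLe-scale r {g} g≤
    e≈ : e ≈ₚ scale r g *ₚ h
    e≈ i = trans (coeff-scale r f i) (trans (cong (r *ℚ_) (f≈gh i)) (sym (coeff-scale-* r g h i)))

  factors : ∀ g h → f ≈ₚ g *ₚ h → IsUnit g ⊎ IsUnit h
  factors g h f≈gh with ≈[]-or-HasDeg g | ≈[]-or-HasDeg h
  ... | inj₁ g≈[] | _ = ⊥-elim (f₀≢0 (trans (f≈gh 0) (*ₚ-zeroˡ g h g≈[] 0)))
  ... | inj₂ _    | inj₁ h≈[] = ⊥-elim (f₀≢0 (trans (f≈gh 0) (trans (*ₚ-comm g h 0) (*ₚ-zeroˡ h g h≈[] 0))))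
  ... | inj₂ (a , g-deg) | inj₂ (b , h-deg) =
    -- The criteria speak of degree bounds only; with exact degrees the bounds add up to m, and a
    -- bound equal to 0 means a nonzero constant.
    map (λ a≡0 → HasDeg-0⇒IsUnit {g} (subst (HasDeg g) a≡0 g-deg)) (λ b≡0 → HasDeg-0⇒IsUnit {h} (subst (HasDeg h) b≡0 h-deg))
      (no-factors g h (proj₁ g-deg) (proj₁ h-deg)
        (sym (HasDeg-unique {f} {g *ₚ h} f≈gh f-deg (HasDeg-* {g} {h} g-deg h-deg))) f≈gh)

theorem8p1 : (n k : ℕ) → 1 ≤ n → k < n → (P Q : Poly) → IsPQPair n P Q →
    Prime (n + k + 1) ⊎ Prime (2 * n + 1) → Irreducible (derivⁿ k Q)
theorem8p1 n k _ k<n P Q pq primes =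
  let (f≤m , rec , f₀≢0) = derivⁿ-properties {n} {P} {Q} pq k m k+m≡n in
  Recurrence⇒Irreducible {k + n} {m} (derivⁿ k Q) (ℕₚ.m<n⇒0<n∸m k<n)
    (s≤s (ℕₚ.≤-trans (ℕₚ.m∸n≤m n k) (ℕₚ.m≤n+m n k))) f≤m rec f₀≢0 (map (subst Prime K-eq) (subst Prime K+m-eq) primes)
  where
  open ≡-Reasoning
  m : ℕ
  m = n ℕ.∸ k
  k+m≡n : k + m ≡ n
  k+m≡n = ℕₚ.m+[n∸m]≡n (ℕₚ.<⇒≤ k<n)
  K-eq : n + k + 1 ≡ suc (k + n)
  K-eq = trans (ℕₚ.+-comm (n + k) 1) (cong suc (ℕₚ.+-comm n k))
  K+m-eq : 2 * n + 1 ≡ suc (k + n) + m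
  K+m-eq = begin
    2 * n + 1               ≡⟨ ℕₚ.+-comm (2 * n) 1 ⟩
    suc (n + (n + 0))       ≡⟨ cong (λ j → suc (n + j)) (trans (ℕₚ.+-identityʳ n) (sym k+m≡n)) ⟩
    suc (n + (k + m))       ≡⟨ cong suc (ℕₚ.+-assoc n k m) ⟨
    suc (n + k + m)         ≡⟨ cong (λ j → suc (j + m)) (ℕₚ.+-comm n k) ⟩
    suc (k + n) + m         ∎
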